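{- For all (possibly open) plain terms $t_0,t_1$ of $\lambda_S$, if $t_0\approx_o t_1$ then $t_0\cong_p^\circ t_1$ (for closed terms, $t_0\cong_p t_1$).
   Context: Plain calculus $\lambda_S$: terms $t ::= v \mid t\,t \mid \mathcal{S}k.t \mid \langle t\rangle$, values $v ::= x \mid \lambda x.t$; pure contexts $E ::= \square \mid v\,E \mid E\,t$; evaluation contexts $F ::= \square \mid v\,F \mid F\,t \mid \langle F\rangle$; contexts $C ::= \square \mid \lambda x.C \mid t\,C \mid C\,t \mid \mathcal{S}k.C \mid \langle C\rangle$. $t\Downarrow t'$: $t\to^*t'$ with $t'$ a normal form. For closed terms, $t_0\cong_p t_1$ iff for every closed context $C$, $\langle C[t_0]\rangle$ evaluates to a value iff $\langle C[t_1]\rangle$ does; $t_0\cong_p^\circ t_1$ iff $t_0\sigma\cong_p t_1\sigma$ for every substitution $\sigma$ of closed values for free variables. Extended calculus: context variables $\alpha$; terms add $\alpha\langle t\rangle$ (a new construct, $\alpha$ standing for an unknown delimited context); evaluation contexts add $\alpha\langle F\rangle$; delimited contexts $D ::= \langle E\rangle\mid\alpha\langle E\rangle$ (every evaluation context is pure or uniquely $F[D]$). Reduction: $F[(\lambda x.t)\,v] \to F[t\{v/x\}]$; $F[D[\mathcal{S}k.t]]\to F[\langle t\{\lambda x.D[x]/k\}\rangle]$ ($x\notin\mathrm{fv}(D)$); $F[\langle v\rangle]\to F[v]$. Normal forms: values, open-stuck $F[x\,v]$, control-stuck $E[\mathcal{S}k.t]$, context-stuck $F[\alpha\langle v\rangle]$.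 Pure terms $p ::= v\mid\langle t\rangle\mid\alpha\langle t\rangle$. Extensions of $R$ ($x$, $\alpha$ fresh): $F_0[D_0]\,R^c\,F_1[D_1]$ iff $D_0[x]\,R\,D_1[x]$ and $F_0[x]\,R\,F_1[x]$; $v_0\,R^v\,v_1$ iff $\alpha\langle v_0\,x\rangle\,R\,\alpha\langle v_1\,x\rangle$; $F_0[y\,v_0]\,R^{nf}\,F_1[y\,v_1]$ iff $F_0\,R^c\,F_1$ and $v_0\,R^v\,v_1$. A pure normal-form bisimulation is a relation $R$ on open extended pure terms such that $p_0\,R\,p_1$ implies: $p_0\to p_0'$ gives $p_1\to^*p_1'$ with $p_0'\,R\,p_1'$; $p_0$ value gives $p_1\Downarrow v_1$ with $p_0\,R^v\,v_1$; if $p_0=F_0[\alpha\langle v_0\rangle]$ then $p_1\Downarrow F_1[\alpha\langle v_1\rangle]$ with $F_0[\langle\square\rangle]\,R^c\,F_1[\langle\square\rangle]$ and $v_0\,R^v\,v_1$; if $p_0$ is open-stuck then $p_1\Downarrow p_1'$ with $p_0\,R^{nf}\,p_1'$; and symmetrically. $\approx_o$ is the largest one, extended to arbitrary terms by: $t_0\approx_o t_1$ iff $\alpha\langle t_0\rangle\approx_o\alpha\langle t_1\rangle$ for a fresh $\alpha$. -}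

module Defs where

open import Data.Nat using (ℕ; zero; suc; _⊔_; pred; _<_)
open import Data.Product using (Σ; _×_; _,_)
open import Data.Sum using (_⊎_)
open import Function using (flip)
open import Function.Bundles using (_⇔_)
open import Relation.Nullary using (¬_)
open import Relation.Binary.PropositionalEquality using (_≡_)
open import Relation.Binary.Construct.Closure.ReflexiveTransitive using (Star)

-- Syntax of the extended calculus (λ_S plus context variables α⟨t⟩).
-- Term variables: de Bruijn indices (lam and sft bind index 0).
-- Context variables α: names (ℕ); they are never bound.

data Term : Set where
  var : ℕ → Term
  lam : Term → Term
  app : Term → Term → Term
  sft : Term → Term
  rst : Term → Term
  cv  : ℕ → Term → Term

data Value : Term → Set where
  vvar : ∀ x → Value (var x)
  vlam : ∀ t → Value (lam t)

data Plain : Term → Set where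
  pvar : ∀ x → Plain (var x)
  plam : ∀ {t} → Plain t → Plain (lam t)
  papp : ∀ {t u} → Plain t → Plain u → Plain (app t u)
  psft : ∀ {t} → Plain t → Plain (sft t)
  prst : ∀ {t} → Plain t → Plain (rst t)

data PureT : Term → Set where
  pval : ∀ {v} → Value v → PureT v
  prs  : ∀ t → PureT (rst t)
  pcv  : ∀ α t → PureT (cv α t)

data Scoped : ℕ → Term → Set where
  svar : ∀ {n x} → x < n → Scoped n (var x)
  slam : ∀ {n t} → Scoped (suc n) t → Scoped n (lam t)
  sapp : ∀ {n t u} → Scoped n t → Scoped n u → Scoped n (app t u)
  ssft : ∀ {n t} → Scoped (suc n) t → Scoped n (sft t)
  srst : ∀ {n t} → Scoped n t → Scoped n (rst t)
  scv  : ∀ {n α t} → Scoped n t → Scoped n (cv α t)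

Closed : Term → Set
Closed = Scoped 0

ext : (ℕ → ℕ) → ℕ → ℕ
ext ρ zero    = zero
ext ρ (suc n) = suc (ρ n)

ren : (ℕ → ℕ) → Term → Term
ren ρ (var x)   = var (ρ x)
ren ρ (lam t)   = lam (ren (ext ρ) t)
ren ρ (app t u) = app (ren ρ t) (ren ρ u)
ren ρ (sft t)   = sft (ren (ext ρ) t)
ren ρ (rst t)   = rst (ren ρ t)
ren ρ (cv α t)  = cv α (ren ρ t)

exts : (ℕ → Term) → ℕ → Term
exts σ zero    = var zero
exts σ (suc n) = ren suc (σ n)

sub : (ℕ → Term) → Term → Term
sub σ (var x)   = σ x
sub σ (lam t)   = lam (sub (exts σ) t)
sub σ (app t u) = app (sub σ t) (sub σ u)
sub σ (sft t)   = sft (sub (exts σ) t)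
sub σ (rst t)   = rst (sub σ t)
sub σ (cv α t)  = cv α (sub σ t)

_[_]₀ : Term → Term → Term
t [ u ]₀ = sub σ t
  where
  σ : ℕ → Term
  σ zero    = u
  σ (suc n) = var n

renValue : ∀ ρ {v} → Value v → Value (ren ρ v)
renValue ρ (vvar x) = vvar (ρ x)
renValue ρ (vlam t) = vlam (ren (ext ρ) t)

data ECtx : Set where
  □E : ECtx
  vE : (v : Term) → Value v → ECtx → ECtx
  Et : ECtx → Term → ECtx

data FCtx : Set where
  □F : FCtx
  vF : (v : Term) → Value v → FCtx → FCtx
  Ft : FCtx → Term → FCtx
  rF : FCtx → FCtx
  cF : ℕ → FCtx → FCtx

data DCtx : Set where
  rD : ECtx → DCtx
  cD : ℕ → ECtx → DCtx

plugE : ECtx → Term → Term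
plugE □E        t = t
plugE (vE v _ E) t = app v (plugE E t)
plugE (Et E u)  t = app (plugE E t) u

plugF : FCtx → Term → Term
plugF □F         t = t
plugF (vF v _ F) t = app v (plugF F t)
plugF (Ft F u)   t = app (plugF F t) u
plugF (rF F)     t = rst (plugF F t)
plugF (cF α F)   t = cv α (plugF F t)

plugD : DCtx → Term → Term
plugD (rD E)   t = rst (plugE E t)
plugD (cD α E) t = cv α (plugE E t)

renE : (ℕ → ℕ) → ECtx → ECtx
renE ρ □E         = □E
renE ρ (vE v p E) = vE (ren ρ v) (renValue ρ p) (renE ρ E)
renE ρ (Et E u)   = Et (renE ρ E) (ren ρ u)

renD : (ℕ → ℕ) → DCtx → DCtx
renD ρ (rD E)   = rD (renE ρ E)
renD ρ (cD α E) = cD α (renE ρ E)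

eToF : ECtx → FCtx
eToF □E         = □F
eToF (vE v p E) = vF v p (eToF E)
eToF (Et E u)   = Ft (eToF E) u

dToF : DCtx → FCtx
dToF (rD E)   = rF (eToF E)
dToF (cD α E) = cF α (eToF E)

_∘F_ : FCtx → FCtx → FCtx
□F         ∘F G = G
(vF v p F) ∘F G = vF v p (F ∘F G)
(Ft F u)   ∘F G = Ft (F ∘F G) u
(rF F)     ∘F G = rF (F ∘F G)
(cF α F)   ∘F G = cF α (F ∘F G)

data _⟶_ : Term → Term → Set where
  βv    : ∀ F t v → Value v →
          plugF F (app (lam t) v) ⟶ plugF F (t [ v ]₀)
  shift : ∀ F D t →
          plugF F (plugD D (sft t)) ⟶
          plugF F (rst (t [ lam (plugD (renD suc D) (var zero)) ]₀))
  reset : ∀ F v → Value v → plugF F (rst v) ⟶ plugF F v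

_⟶*_ : Term → Term → Set
_⟶*_ = Star _⟶_

Normal : Term → Set
Normal t = ¬ Σ Term (λ t′ → t ⟶ t′)

_⇓_ : Term → Term → Set
t ⇓ t′ = (t ⟶* t′) × Normal t′

tb : Term → ℕ
tb (var x)   = suc x
tb (lam t)   = pred (tb t)
tb (app t u) = tb t ⊔ tb u
tb (sft t)   = pred (tb t)
tb (rst t)   = tb t
tb (cv α t)  = tb t

cb : Term → ℕ
cb (var x)   = zero
cb (lam t)   = cb t
cb (app t u) = cb t ⊔ cb u
cb (sft t)   = cb t
cb (rst t)   = cb t
cb (cv α t)  = suc α ⊔ cb t

Rel : Set₁
Rel = Term → Term → Set

-- v₀ R^v v₁ iff α⟨v₀ x⟩ R α⟨v₁ x⟩   (x, α fresh)
RelV : Rel → Term → Term → Set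
RelV R v₀ v₁ = R (cv a (app v₀ (var x))) (cv a (app v₁ (var x)))
  where
  x = tb v₀ ⊔ tb v₁
  a = cb v₀ ⊔ cb v₁

-- F₀[D₀] R^c F₁[D₁] iff D₀[x] R D₁[x] and F₀[x] R F₁[x]   (x fresh)
RelC : Rel → FCtx → FCtx → Set
RelC R G₀ G₁ =
  Σ FCtx λ F₀ → Σ DCtx λ D₀ → Σ FCtx λ F₁ → Σ DCtx λ D₁ →
    (G₀ ≡ F₀ ∘F dToF D₀) × (G₁ ≡ F₁ ∘F dToF D₁) ×
    R (plugD D₀ (var x)) (plugD D₁ (var x)) ×
    R (plugF F₀ (var x)) (plugF F₁ (var x))
  where
  x = tb (plugF G₀ (var zero)) ⊔ tb (plugF G₁ (var zero))

RelNF : Rel → Term → Term → Set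
RelNF R t₀ t₁ =
  Σ FCtx λ F₀ → Σ FCtx λ F₁ → Σ ℕ λ y → Σ Term λ v₀ → Σ Term λ v₁ →
    Value v₀ × Value v₁ ×
    (t₀ ≡ plugF F₀ (app (var y) v₀)) × (t₁ ≡ plugF F₁ (app (var y) v₁)) ×
    RelC R F₀ F₁ × RelV R v₀ v₁

record Progress (R : Rel) : Set where
  field
    step : ∀ {p₀ p₁ p₀′} → R p₀ p₁ → p₀ ⟶ p₀′ →
           Σ Term λ p₁′ → (p₁ ⟶* p₁′) × R p₀′ p₁′
    val  : ∀ {p₀ p₁} → R p₀ p₁ → Value p₀ →
           Σ Term λ v₁ → (p₁ ⇓ v₁) × Value v₁ × RelV R p₀ v₁
    ctx  : ∀ {p₁} F₀ α v₀ → Value v₀ → R (plugF F₀ (cv α v₀)) p₁ →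
           Σ FCtx λ F₁ → Σ Term λ v₁ → Value v₁ ×
             (p₁ ⇓ plugF F₁ (cv α v₁)) ×
             RelC R (F₀ ∘F rF □F) (F₁ ∘F rF □F) × RelV R v₀ v₁
    opn  : ∀ {p₁} F₀ y v₀ → Value v₀ → R (plugF F₀ (app (var y) v₀)) p₁ →
           Σ Term λ p₁′ → (p₁ ⇓ p₁′) × RelNF R (plugF F₀ (app (var y) v₀)) p₁′

record IsPureNFBisim (R : Rel) : Set where
  field
    pure : ∀ {p₀ p₁} → R p₀ p₁ → PureT p₀ × PureT p₁
    fwd  : Progress R
    bwd  : Progress (flip R)

_≈ₒ_ : Term → Term → Set₁
p₀ ≈ₒ p₁ = Σ Rel λ R → IsPureNFBisim R × R p₀ p₁

-- extension to arbitrary terms: t₀ ≈ₒ t₁ iff α⟨t₀⟩ ≈ₒ α⟨t₁⟩, α fresh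
_≈ₒᵗ_ : Term → Term → Set₁
t₀ ≈ₒᵗ t₁ = cv a t₀ ≈ₒ cv a t₁
  where
  a = cb t₀ ⊔ cb t₁

data Ctx : Set where
  hole  : Ctx
  lamC  : Ctx → Ctx
  appRC : Term → Ctx → Ctx
  appLC : Ctx → Term → Ctx
  sftC  : Ctx → Ctx
  rstC  : Ctx → Ctx

plugC : Ctx → Term → Term
plugC hole        t = t
plugC (lamC C)    t = lam (plugC C t)
plugC (appRC u C) t = app u (plugC C t)
plugC (appLC C u) t = app (plugC C t) u
plugC (sftC C)    t = sft (plugC C t)
plugC (rstC C)    t = rst (plugC C t)

data PlainC : Ctx → Set where
  phole  : PlainC hole
  plamC  : ∀ {C} → PlainC C → PlainC (lamC C)
  pappRC : ∀ {u C} → Plain u → PlainC C → PlainC (appRC u C)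
  pappLC : ∀ {C u} → PlainC C → Plain u → PlainC (appLC C u)
  psftC  : ∀ {C} → PlainC C → PlainC (sftC C)
  prstC  : ∀ {C} → PlainC C → PlainC (rstC C)

data ScopedC : ℕ → Ctx → Set where
  shole  : ∀ {n} → ScopedC n hole
  slamC  : ∀ {n C} → ScopedC (suc n) C → ScopedC n (lamC C)
  sappRC : ∀ {n u C} → Scoped n u → ScopedC n C → ScopedC n (appRC u C)
  sappLC : ∀ {n C u} → ScopedC n C → Scoped n u → ScopedC n (appLC C u)
  ssftC  : ∀ {n C} → ScopedC (suc n) C → ScopedC n (sftC C)
  srstC  : ∀ {n C} → ScopedC n C → ScopedC n (rstC C)

ClosedC : Ctx → Set
ClosedC = ScopedC 0

EvalsToValue : Term → Set
EvalsToValue t = Σ Term λ v → (t ⟶* v) × Value v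

_≅p_ : Term → Term → Set
t₀ ≅p t₁ = ∀ C → PlainC C → ClosedC C →
           EvalsToValue (rst (plugC C t₀)) ⇔ EvalsToValue (rst (plugC C t₁))

ClosingSubst : (ℕ → Term) → Set
ClosingSubst σ = ∀ x → Value (σ x) × Plain (σ x) × Closed (σ x)

_≅p°_ : Term → Term → Set
t₀ ≅p° t₁ = ∀ σ → ClosingSubst σ → sub σ t₀ ≅p sub σ t₁

{-# OPTIONS --safe #-}
module Submission where

-- Close a bisimulation R under instantiation of variables by related closed
-- values and of context variables by related closed pure contexts, and under
-- plain contexts.  By induction on the number of steps the left side takes to
-- reach a value, the right side reaches a value too.  A step internal to an
-- R-related pair is matched by R.  When the left component of such a pair is
-- stuck on y v or α⟨v⟩, R decomposes both sides into related values and contexts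
-- and control passes to what y or α stands for.  No step is spent on this
-- hand-over, but it moves to a subderivation of the closure, so it can only be
-- repeated finitely often before the left side really reduces.  R is used only
-- through instances, so it need not be closed under renaming of fresh variables.

open import Defs
open import Data.Empty using (⊥-elim)
open import Data.Maybe as Maybe using (Maybe; just; nothing; maybe)
open import Data.Maybe.Properties using (just-injective)
open import Data.Nat using (ℕ; zero; suc; _⊔_; pred; _<_; _≤_; z≤n; s≤s)
open import Data.Nat.Properties using (_≟_; ≤-refl; <-≤-trans; <⇒≢; m≤m⊔n; m≤n⊔m; m≤n⇒m≤n⊔o; m≤n⇒m≤o⊔n; ⊔-lub; m⊔n≤o⇒m≤o; m⊔n≤o⇒n≤o; ⊔-mono-≤)
open import Data.Product as Product using (Σ; _×_; _,_; proj₁; proj₂)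
open import Data.Unit using (⊤; tt)
open import Function using (flip; _∘_; id)
open import Function.Bundles using (mk⇔)
open import Relation.Nullary using (¬_; yes; no)
open import Relation.Binary.PropositionalEquality using (_≡_; refl; sym; trans; cong; cong₂; subst; subst₂; module ≡-Reasoning)
open import Relation.Binary.Construct.Closure.ReflexiveTransitive using (ε; _◅_; _◅◅_; gmap)

-- Renaming and substitution

ext-cong : ∀ {ρ ρ′ : ℕ → ℕ} → (∀ x → ρ x ≡ ρ′ x) → ∀ x → ext ρ x ≡ ext ρ′ x
ext-cong h zero    = refl
ext-cong h (suc x) = cong suc (h x)

ren-cong : ∀ {ρ ρ′} → (∀ x → ρ x ≡ ρ′ x) → ∀ t → ren ρ t ≡ ren ρ′ t
ren-cong h (var x)   = cong var (h x)
ren-cong h (lam t)   = cong lam (ren-cong (ext-cong h) t)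
ren-cong h (app t u) = cong₂ app (ren-cong h t) (ren-cong h u)
ren-cong h (sft t)   = cong sft (ren-cong (ext-cong h) t)
ren-cong h (rst t)   = cong rst (ren-cong h t)
ren-cong h (cv α t)  = cong (cv α) (ren-cong h t)

exts-cong : ∀ {σ τ : ℕ → Term} → (∀ x → σ x ≡ τ x) → ∀ x → exts σ x ≡ exts τ x
exts-cong h zero    = refl
exts-cong h (suc x) = cong (ren suc) (h x)

sub-cong : ∀ {σ τ} → (∀ x → σ x ≡ τ x) → ∀ t → sub σ t ≡ sub τ t
sub-cong h (var x)   = h x
sub-cong h (lam t)   = cong lam (sub-cong (exts-cong h) t)
sub-cong h (app t u) = cong₂ app (sub-cong h t) (sub-cong h u)
sub-cong h (sft t)   = cong sft (sub-cong (exts-cong h) t)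
sub-cong h (rst t)   = cong rst (sub-cong h t)
sub-cong h (cv α t)  = cong (cv α) (sub-cong h t)

ext-∘ : ∀ (ρ ρ′ : ℕ → ℕ) x → ext ρ′ (ext ρ x) ≡ ext (ρ′ ∘ ρ) x
ext-∘ ρ ρ′ zero    = refl
ext-∘ ρ ρ′ (suc x) = refl

ren-ren : ∀ ρ ρ′ t → ren ρ′ (ren ρ t) ≡ ren (ρ′ ∘ ρ) t
ren-ren ρ ρ′ (var x)   = refl
ren-ren ρ ρ′ (lam t)   = cong lam (trans (ren-ren _ _ t) (ren-cong (ext-∘ ρ ρ′) t))
ren-ren ρ ρ′ (app t u) = cong₂ app (ren-ren ρ ρ′ t) (ren-ren ρ ρ′ u)
ren-ren ρ ρ′ (sft t)   = cong sft (trans (ren-ren _ _ t) (ren-cong (ext-∘ ρ ρ′) t))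
ren-ren ρ ρ′ (rst t)   = cong rst (ren-ren ρ ρ′ t)
ren-ren ρ ρ′ (cv α t)  = cong (cv α) (ren-ren ρ ρ′ t)

ren-ext-suc : ∀ ρ t → ren (ext ρ) (ren suc t) ≡ ren suc (ren ρ t)
ren-ext-suc ρ t = trans (ren-ren suc (ext ρ) t) (sym (ren-ren ρ suc t))

exts-ext : ∀ ρ (σ : ℕ → Term) x → exts σ (ext ρ x) ≡ exts (σ ∘ ρ) x
exts-ext ρ σ zero    = refl
exts-ext ρ σ (suc x) = refl

sub-ren : ∀ ρ σ t → sub σ (ren ρ t) ≡ sub (σ ∘ ρ) t
sub-ren ρ σ (var x)   = refl
sub-ren ρ σ (lam t)   = cong lam (trans (sub-ren _ _ t) (sub-cong (exts-ext ρ σ) t))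
sub-ren ρ σ (app t u) = cong₂ app (sub-ren ρ σ t) (sub-ren ρ σ u)
sub-ren ρ σ (sft t)   = cong sft (trans (sub-ren _ _ t) (sub-cong (exts-ext ρ σ) t))
sub-ren ρ σ (rst t)   = cong rst (sub-ren ρ σ t)
sub-ren ρ σ (cv α t)  = cong (cv α) (sub-ren ρ σ t)

ren-exts : ∀ ρ (σ : ℕ → Term) x → ren (ext ρ) (exts σ x) ≡ exts (ren ρ ∘ σ) x
ren-exts ρ σ zero    = refl
ren-exts ρ σ (suc x) = ren-ext-suc ρ (σ x)

ren-sub : ∀ ρ σ t → ren ρ (sub σ t) ≡ sub (ren ρ ∘ σ) t
ren-sub ρ σ (var x)   = refl
ren-sub ρ σ (lam t)   = cong lam (trans (ren-sub _ _ t) (sub-cong (ren-exts ρ σ) t))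
ren-sub ρ σ (app t u) = cong₂ app (ren-sub ρ σ t) (ren-sub ρ σ u)
ren-sub ρ σ (sft t)   = cong sft (trans (ren-sub _ _ t) (sub-cong (ren-exts ρ σ) t))
ren-sub ρ σ (rst t)   = cong rst (ren-sub ρ σ t)
ren-sub ρ σ (cv α t)  = cong (cv α) (ren-sub ρ σ t)

sub-exts-suc : ∀ σ t → sub (exts σ) (ren suc t) ≡ ren suc (sub σ t)
sub-exts-suc σ t = trans (sub-ren suc (exts σ) t) (sym (ren-sub suc σ t))

sub-exts : ∀ (σ τ : ℕ → Term) x → sub (exts τ) (exts σ x) ≡ exts (sub τ ∘ σ) x
sub-exts σ τ zero    = refl
sub-exts σ τ (suc x) = sub-exts-suc τ (σ x)

single : Term → ℕ → Term
single u zero    = u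
single u (suc x) = var x

[]₀-single : ∀ t u → t [ u ]₀ ≡ sub (single u) t
[]₀-single t u = sub-cong (λ { zero → refl ; (suc x) → refl }) t

-- Scoping

ext-id : ∀ {n} {ρ : ℕ → ℕ} → (∀ x → x < n → ρ x ≡ x) → ∀ x → x < suc n → ext ρ x ≡ x
ext-id h zero    _       = refl
ext-id h (suc x) (s≤s l) = cong suc (h x l)

ren-scoped-id : ∀ {n ρ t} → Scoped n t → (∀ x → x < n → ρ x ≡ x) → ren ρ t ≡ t
ren-scoped-id (svar l)   h = cong var (h _ l)
ren-scoped-id (slam s)   h = cong lam (ren-scoped-id s (ext-id h))
ren-scoped-id (sapp s r) h = cong₂ app (ren-scoped-id s h) (ren-scoped-id r h)
ren-scoped-id (ssft s)   h = cong sft (ren-scoped-id s (ext-id h))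
ren-scoped-id (srst s)   h = cong rst (ren-scoped-id s h)
ren-scoped-id (scv s)    h = cong (cv _) (ren-scoped-id s h)

exts-id : ∀ {n} {σ : ℕ → Term} → (∀ x → x < n → σ x ≡ var x) →
          ∀ x → x < suc n → exts σ x ≡ var x
exts-id h zero    _       = refl
exts-id h (suc x) (s≤s l) = cong (ren suc) (h x l)

sub-scoped-id : ∀ {n σ t} → Scoped n t → (∀ x → x < n → σ x ≡ var x) → sub σ t ≡ t
sub-scoped-id (svar l)   h = h _ l
sub-scoped-id (slam s)   h = cong lam (sub-scoped-id s (exts-id h))
sub-scoped-id (sapp s r) h = cong₂ app (sub-scoped-id s h) (sub-scoped-id r h)
sub-scoped-id (ssft s)   h = cong sft (sub-scoped-id s (exts-id h))
sub-scoped-id (srst s)   h = cong rst (sub-scoped-id s h)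
sub-scoped-id (scv s)    h = cong (cv _) (sub-scoped-id s h)

ren-closed : ∀ {ρ t} → Closed t → ren ρ t ≡ t
ren-closed s = ren-scoped-id s (λ _ ())

sub-closed : ∀ {σ t} → Closed t → sub σ t ≡ t
sub-closed s = sub-scoped-id s (λ _ ())

ext-scoped : ∀ {n m} {ρ : ℕ → ℕ} → (∀ x → x < n → ρ x < m) →
             ∀ x → x < suc n → ext ρ x < suc m
ext-scoped h zero    _       = s≤s z≤n
ext-scoped h (suc x) (s≤s l) = s≤s (h x l)

ren-scoped : ∀ {n m ρ t} → Scoped n t → (∀ x → x < n → ρ x < m) → Scoped m (ren ρ t)
ren-scoped (svar l)   h = svar (h _ l)
ren-scoped (slam s)   h = slam (ren-scoped s (ext-scoped h))
ren-scoped (sapp s r) h = sapp (ren-scoped s h) (ren-scoped r h)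
ren-scoped (ssft s)   h = ssft (ren-scoped s (ext-scoped h))
ren-scoped (srst s)   h = srst (ren-scoped s h)
ren-scoped (scv s)    h = scv (ren-scoped s h)

closed⇒scoped : ∀ {n t} → Closed t → Scoped n t
closed⇒scoped s = subst (Scoped _) (ren-closed {id} s) (ren-scoped s (λ _ ()))

-- Contexts

_∘E_ : ECtx → ECtx → ECtx
□E         ∘E G = G
(vE v p E) ∘E G = vE v p (E ∘E G)
(Et E u)   ∘E G = Et (E ∘E G) u

plugE-∘ : ∀ E G t → plugE (E ∘E G) t ≡ plugE E (plugE G t)
plugE-∘ □E         G t = refl
plugE-∘ (vE v p E) G t = cong (app v) (plugE-∘ E G t)
plugE-∘ (Et E u)   G t = cong (λ s → app s u) (plugE-∘ E G t)

plugF-∘ : ∀ F G t → plugF (F ∘F G) t ≡ plugF F (plugF G t)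
plugF-∘ □F         G t = refl
plugF-∘ (vF v p F) G t = cong (app v) (plugF-∘ F G t)
plugF-∘ (Ft F u)   G t = cong (λ s → app s u) (plugF-∘ F G t)
plugF-∘ (rF F)     G t = cong rst (plugF-∘ F G t)
plugF-∘ (cF α F)   G t = cong (cv α) (plugF-∘ F G t)

plugF-eToF : ∀ E t → plugF (eToF E) t ≡ plugE E t
plugF-eToF □E         t = refl
plugF-eToF (vE v p E) t = cong (app v) (plugF-eToF E t)
plugF-eToF (Et E u)   t = cong (λ s → app s u) (plugF-eToF E t)

plugF-dToF : ∀ D t → plugF (dToF D) t ≡ plugD D t
plugF-dToF (rD E)   t = cong rst (plugF-eToF E t)
plugF-dToF (cD α E) t = cong (cv α) (plugF-eToF E t)

-- The context surrounding the innermost delimiter.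
outer : FCtx → Maybe FCtx
outer □F         = nothing
outer (vF v p F) = Maybe.map (vF v p) (outer F)
outer (Ft F u)   = Maybe.map (λ G → Ft G u) (outer F)
outer (rF F)     = just (maybe rF □F (outer F))
outer (cF α F)   = just (maybe (cF α) □F (outer F))

outer-eToF : ∀ E → outer (eToF E) ≡ nothing
outer-eToF □E         = refl
outer-eToF (vE v p E) = cong (Maybe.map _) (outer-eToF E)
outer-eToF (Et E u)   = cong (Maybe.map _) (outer-eToF E)

outer-∘dToF : ∀ F D → outer (F ∘F dToF D) ≡ just F
outer-∘dToF □F         (rD E)   = cong (just ∘ maybe rF □F) (outer-eToF E)
outer-∘dToF □F         (cD α E) = cong (just ∘ maybe (cF α) □F) (outer-eToF E)
outer-∘dToF (vF v p F) D        = cong (Maybe.map _) (outer-∘dToF F D)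
outer-∘dToF (Ft F u)   D        = cong (Maybe.map _) (outer-∘dToF F D)
outer-∘dToF (rF F)     D        = cong (just ∘ maybe rF □F) (outer-∘dToF F D)
outer-∘dToF (cF α F)   D        = cong (just ∘ maybe (cF α) □F) (outer-∘dToF F D)

-- `RelC` only asserts that some decomposition exists. Since `outer` computes its outer part, the
-- one supplied can be identified with the one expected.
∘dToF-injectiveˡ : ∀ {F F′} D D′ → F ∘F dToF D ≡ F′ ∘F dToF D′ → F ≡ F′
∘dToF-injectiveˡ {F} {F′} D D′ e =
  just-injective (trans (sym (outer-∘dToF F D)) (trans (cong outer e) (outer-∘dToF F′ D′)))

plugF-⟶ : ∀ F {t t′} → t ⟶ t′ → plugF F t ⟶ plugF F t′
plugF-⟶ F (βv G t v p)  = subst₂ _⟶_ (plugF-∘ F G _) (plugF-∘ F G _) (βv (F ∘F G) t v p)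
plugF-⟶ F (shift G D t) = subst₂ _⟶_ (plugF-∘ F G _) (plugF-∘ F G _) (shift (F ∘F G) D t)
plugF-⟶ F (reset G v p) = subst₂ _⟶_ (plugF-∘ F G _) (plugF-∘ F G _) (reset (F ∘F G) v p)

plugF-⟶* : ∀ F {t t′} → t ⟶* t′ → plugF F t ⟶* plugF F t′
plugF-⟶* F = gmap (plugF F) (plugF-⟶ F)

ClosedE : ECtx → Set
ClosedE □E         = ⊤
ClosedE (vE v _ E) = Closed v × ClosedE E
ClosedE (Et E u)   = ClosedE E × Closed u

∘E-closed : ∀ E {G} → ClosedE E → ClosedE G → ClosedE (E ∘E G)
∘E-closed □E         _       c = c
∘E-closed (vE v _ E) (s , e) c = s , ∘E-closed E e c
∘E-closed (Et E u)   (e , s) c = ∘E-closed E e c , s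

ren-plugE : ∀ {ρ} E {t} → ClosedE E → ren ρ (plugE E t) ≡ plugE E (ren ρ t)
ren-plugE □E         _       = refl
ren-plugE (vE v _ E) (s , c) = cong₂ app (ren-closed s) (ren-plugE E c)
ren-plugE (Et E u)   (c , s) = cong₂ app (ren-plugE E c) (ren-closed s)

sub-plugE : ∀ {σ} E {t} → ClosedE E → sub σ (plugE E t) ≡ plugE E (sub σ t)
sub-plugE □E         _       = refl
sub-plugE (vE v _ E) (s , c) = cong₂ app (sub-closed s) (sub-plugE E c)
sub-plugE (Et E u)   (c , s) = cong₂ app (sub-plugE E c) (sub-closed s)

plugE-renE : ∀ {ρ} E {t} → ClosedE E → plugE (renE ρ E) t ≡ plugE E t
plugE-renE □E         _       = refl
plugE-renE (vE v _ E) (s , c) = cong₂ app (ren-closed s) (plugE-renE E c)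
plugE-renE (Et E u)   (c , s) = cong₂ app (plugE-renE E c) (ren-closed s)

plugE-scoped : ∀ {n} E {t} → ClosedE E → Scoped n t → Scoped n (plugE E t)
plugE-scoped □E         _       r = r
plugE-scoped (vE v _ E) (s , c) r = sapp (closed⇒scoped s) (plugE-scoped E c r)
plugE-scoped (Et E u)   (c , s) r = sapp (plugE-scoped E c r) (closed⇒scoped s)

-- Determinism and progress

capture : DCtx → Term → Term
capture D t = rst (t [ lam (plugD (renD suc D) (var zero)) ]₀)

-- Computing the reduct by a function turns determinism into an equation, so two redex
-- decompositions are never compared. `control` keeps its pure context because an enclosing
-- delimiter needs it for the capture.
data Outcome (t : Term) : Set where
  value   : Value t → Outcome t
  stuck   : Outcome t
  control : ECtx → Term → Outcome t
  reduces : Term → Outcome t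

appOutcome : ∀ t u → Outcome t → Outcome u → Outcome (app t u)
appOutcome t u (value (vvar x)) (value _)     = stuck
appOutcome t u (value (vlam b)) (value _)     = reduces (b [ u ]₀)
appOutcome t u (value p)        stuck         = stuck
appOutcome t u (value p)        (control E b) = control (vE t p E) b
appOutcome t u (value p)        (reduces u′)  = reduces (app t u′)
appOutcome t u stuck            _             = stuck
appOutcome t u (control E b)    _             = control (Et E u) b
appOutcome t u (reduces t′)     _             = reduces (app t′ u)

rstOutcome : ∀ t → Outcome t → Outcome (rst t)
rstOutcome t (value _)     = reduces t
rstOutcome t stuck         = stuck
rstOutcome t (control E b) = reduces (capture (rD E) b)
rstOutcome t (reduces t′)  = reduces (rst t′)

cvOutcome : ∀ α t → Outcome t → Outcome (cv α t)
cvOutcome α t (value _)     = stuck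
cvOutcome α t stuck         = stuck
cvOutcome α t (control E b) = reduces (capture (cD α E) b)
cvOutcome α t (reduces t′)  = reduces (cv α t′)

outcome : ∀ t → Outcome t
outcome (var x)   = value (vvar x)
outcome (lam t)   = value (vlam t)
outcome (app t u) = appOutcome t u (outcome t) (outcome u)
outcome (sft t)   = control □E t
outcome (rst t)   = rstOutcome t (outcome t)
outcome (cv α t)  = cvOutcome α t (outcome t)

outcome-value : ∀ {v} (p : Value v) → outcome v ≡ value p
outcome-value (vvar x) = refl
outcome-value (vlam t) = refl

outcome-plugE : ∀ E t → outcome (plugE E (sft t)) ≡ control E t
outcome-plugE □E         t = refl
outcome-plugE (vE v p E) t rewrite outcome-value p | outcome-plugE E t = vE-control p
  where
  -- `appOutcome` splits on its function value before the argument, so it computes only once `p` is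
  -- a constructor.
  vE-control : ∀ (p : Value v) → appOutcome v (plugE E (sft t)) (value p) (control E t) ≡ control (vE v p E) t
  vE-control (vvar x) = refl
  vE-control (vlam b) = refl
outcome-plugE (Et E u)   t rewrite outcome-plugE E t = refl

outcome-plugF : ∀ F {t t′} → outcome t ≡ reduces t′ → outcome (plugF F t) ≡ reduces (plugF F t′)
outcome-plugF □F         e = e
outcome-plugF (vF v p F) {t} {t′} e rewrite outcome-value p | outcome-plugF F e = vF-reduces p
  where
  vF-reduces : ∀ (p : Value v) →
    appOutcome v (plugF F t) (value p) (reduces (plugF F t′)) ≡ reduces (app v (plugF F t′))
  vF-reduces (vvar x) = refl
  vF-reduces (vlam b) = refl
outcome-plugF (Ft F u)   e rewrite outcome-plugF F e = refl
outcome-plugF (rF F)     e rewrite outcome-plugF F e = refl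
outcome-plugF (cF α F)   e rewrite outcome-plugF F e = refl

outcome-⟶ : ∀ {t t′} → t ⟶ t′ → outcome t ≡ reduces t′
outcome-⟶ (βv F t v p) = outcome-plugF F β-reduces
  where
  β-reduces : outcome (app (lam t) v) ≡ reduces (t [ v ]₀)
  β-reduces rewrite outcome-value p = refl
outcome-⟶ (shift F (rD E) t) = outcome-plugF F (cong (rstOutcome _) (outcome-plugE E t))
outcome-⟶ (shift F (cD α E) t) = outcome-plugF F (cong (cvOutcome α _) (outcome-plugE E t))
outcome-⟶ (reset F v p) = outcome-plugF F (cong (rstOutcome v) (outcome-value p))

⟶-deterministic : ∀ {t u u′} → t ⟶ u → t ⟶ u′ → u ≡ u′
⟶-deterministic r r′ with trans (sym (outcome-⟶ r)) (outcome-⟶ r′)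
... | refl = refl

value-⟶̸ : ∀ {v t} → Value v → ¬ (v ⟶ t)
value-⟶̸ p r with trans (sym (outcome-value p)) (outcome-⟶ r)
... | ()

data EvalsIn : ℕ → Term → Set where
  done : ∀ {v} → Value v → EvalsIn zero v
  step : ∀ {n t t′} → t ⟶ t′ → EvalsIn n t′ → EvalsIn (suc n) t

evalsIn : ∀ {t v} → t ⟶* v → Value v → Σ ℕ λ n → EvalsIn n t
evalsIn ε        p = zero , done p
evalsIn (r ◅ rs) p = let n , e = evalsIn rs p in suc n , step r e

-- By determinism a known step is the first step of any evaluation, so the counter drops by exactly
-- one.
EvalsIn-⟶ : ∀ {n t t′} → t ⟶ t′ → EvalsIn n t → Σ ℕ λ m → n ≡ suc m × EvalsIn m t′
EvalsIn-⟶ r (done p)    = ⊥-elim (value-⟶̸ p r)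
EvalsIn-⟶ r (step r′ e) with ⟶-deterministic r r′
... | refl = _ , refl , e

data Shape : Term → Set where
  value        : ∀ {v} → Value v → Shape v
  reduces      : ∀ {t t′} → t ⟶ t′ → Shape t
  controlStuck : ∀ E t → Shape (plugE E (sft t))
  openStuck    : ∀ F y {v} → Value v → Shape (plugF F (app (var y) v))
  ctxStuck     : ∀ F α {v} → Value v → Shape (plugF F (cv α v))

shape : ∀ t → Shape t
shape (var x) = value (vvar x)
shape (lam t) = value (vlam t)
shape (sft t) = controlStuck □E t
shape (rst t) with shape t
... | value p          = reduces (reset □F t p)
... | reduces r        = reduces (plugF-⟶ (rF □F) r)
... | controlStuck E b = reduces (shift □F (rD E) b)
... | openStuck F y p  = openStuck (rF F) y p
... | ctxStuck F α p   = ctxStuck (rF F) α p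
shape (cv β t) with shape t
... | value p          = ctxStuck □F β p
... | reduces r        = reduces (plugF-⟶ (cF β □F) r)
... | controlStuck E b = reduces (shift □F (cD β E) b)
... | openStuck F y p  = openStuck (cF β F) y p
... | ctxStuck F α p   = ctxStuck (cF β F) α p
shape (app t u) with shape t
... | reduces r        = reduces (plugF-⟶ (Ft □F u) r)
... | controlStuck E b = controlStuck (Et E u) b
... | openStuck F y p  = openStuck (Ft F u) y p
... | ctxStuck F α p   = ctxStuck (Ft F u) α p
... | value p with shape u
...   | reduces r        = reduces (plugF-⟶ (vF t p □F) r)
...   | controlStuck E b = controlStuck (vE t p E) b
...   | openStuck F y q  = openStuck (vF t p F) y q
...   | ctxStuck F α q   = ctxStuck (vF t p F) α q
shape (app .(var x) u) | value (vvar x) | value q = openStuck □F x q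
shape (app .(lam b) u) | value (vlam b) | value q = reduces (βv □F b u q)

-- Bisimulations relate only pure terms, so this excludes control-stuck components when a related
-- pair is analysed by shape.
plugE-sft-impure : ∀ E {t} → ¬ PureT (plugE E (sft t))
plugE-sft-impure □E (pval ())
plugE-sft-impure (vE _ _ _) (pval ())
plugE-sft-impure (Et _ _) (pval ())

-- Instantiation of variables and context variables

-- δ is not renamed under binders: it is only used with closed contexts.
inst : (ℕ → Term) → (ℕ → ECtx) → Term → Term
inst σ δ (var x)   = σ x
inst σ δ (lam t)   = lam (inst (exts σ) δ t)
inst σ δ (app t u) = app (inst σ δ t) (inst σ δ u)
inst σ δ (sft t)   = sft (inst (exts σ) δ t)
inst σ δ (rst t)   = rst (inst σ δ t)
inst σ δ (cv α t)  = rst (plugE (δ α) (inst σ δ t))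

exts-agree : ∀ {n} {σ τ : ℕ → Term} → (∀ x → x < pred n → σ x ≡ τ x) →
             ∀ x → x < n → exts σ x ≡ exts τ x
exts-agree h zero    _       = refl
exts-agree h (suc x) (s≤s l) = cong (ren suc) (h x l)

-- Agreement is demanded only below `tb` and `cb`. Hence names at or above these bounds are fresh:
-- rebinding them leaves the instance unchanged.
inst-agree : ∀ {σ τ δ ε} t → (∀ x → x < tb t → σ x ≡ τ x) →
             (∀ α → α < cb t → δ α ≡ ε α) → inst σ δ t ≡ inst τ ε t
inst-agree (var x)   h k = h x ≤-refl
inst-agree (lam t)   h k = cong lam (inst-agree t (exts-agree h) k)
inst-agree (app t u) h k =
  cong₂ app (inst-agree t (λ x l → h x (m≤n⇒m≤n⊔o (tb u) l)) (λ α l → k α (m≤n⇒m≤n⊔o (cb u) l)))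
            (inst-agree u (λ x l → h x (m≤n⇒m≤o⊔n (tb t) l)) (λ α l → k α (m≤n⇒m≤o⊔n (cb t) l)))
inst-agree (sft t)   h k = cong sft (inst-agree t (exts-agree h) k)
inst-agree (rst t)   h k = cong rst (inst-agree t h k)
inst-agree (cv α t)  h k =
  cong rst (cong₂ plugE (k α (m≤m⊔n (suc α) (cb t))) (inst-agree t h (λ β l → k β (m≤n⇒m≤o⊔n (suc α) l))))

inst-cong : ∀ {σ τ} δ t → (∀ x → σ x ≡ τ x) → inst σ δ t ≡ inst τ δ t
inst-cong δ t h = inst-agree t (λ x _ → h x) (λ _ _ → refl)

inst-plain : ∀ {σ δ t} → Plain t → inst σ δ t ≡ sub σ t
inst-plain (pvar x)   = refl
inst-plain (plam p)   = cong lam (inst-plain p)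
inst-plain (papp p q) = cong₂ app (inst-plain p) (inst-plain q)
inst-plain (psft p)   = cong sft (inst-plain p)
inst-plain (prst p)   = cong rst (inst-plain p)

inst-ren : ∀ ρ σ δ t → inst σ δ (ren ρ t) ≡ inst (σ ∘ ρ) δ t
inst-ren ρ σ δ (var x)   = refl
inst-ren ρ σ δ (lam t)   = cong lam (trans (inst-ren _ _ δ t) (inst-cong δ t (exts-ext ρ σ)))
inst-ren ρ σ δ (app t u) = cong₂ app (inst-ren ρ σ δ t) (inst-ren ρ σ δ u)
inst-ren ρ σ δ (sft t)   = cong sft (trans (inst-ren _ _ δ t) (inst-cong δ t (exts-ext ρ σ)))
inst-ren ρ σ δ (rst t)   = cong rst (inst-ren ρ σ δ t)
inst-ren ρ σ δ (cv α t)  = cong (rst ∘ plugE (δ α)) (inst-ren ρ σ δ t)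

module _ {δ : ℕ → ECtx} (δ-closed : ∀ α → ClosedE (δ α)) where

  ren-inst : ∀ ρ σ t → ren ρ (inst σ δ t) ≡ inst (ren ρ ∘ σ) δ t
  ren-inst ρ σ (var x)   = refl
  ren-inst ρ σ (lam t)   = cong lam (trans (ren-inst _ _ t) (inst-cong δ t (ren-exts ρ σ)))
  ren-inst ρ σ (app t u) = cong₂ app (ren-inst ρ σ t) (ren-inst ρ σ u)
  ren-inst ρ σ (sft t)   = cong sft (trans (ren-inst _ _ t) (inst-cong δ t (ren-exts ρ σ)))
  ren-inst ρ σ (rst t)   = cong rst (ren-inst ρ σ t)
  ren-inst ρ σ (cv α t)  =
    cong rst (trans (ren-plugE (δ α) (δ-closed α)) (cong (plugE (δ α)) (ren-inst ρ σ t)))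

  sub-inst : ∀ τ σ t → sub τ (inst σ δ t) ≡ inst (sub τ ∘ σ) δ t
  sub-inst τ σ (var x)   = refl
  sub-inst τ σ (lam t)   = cong lam (trans (sub-inst _ _ t) (inst-cong δ t (sub-exts σ τ)))
  sub-inst τ σ (app t u) = cong₂ app (sub-inst τ σ t) (sub-inst τ σ u)
  sub-inst τ σ (sft t)   = cong sft (trans (sub-inst _ _ t) (inst-cong δ t (sub-exts σ τ)))
  sub-inst τ σ (rst t)   = cong rst (sub-inst τ σ t)
  sub-inst τ σ (cv α t)  =
    cong rst (trans (sub-plugE (δ α) (δ-closed α)) (cong (plugE (δ α)) (sub-inst τ σ t)))

  inst-exts : ∀ σ τ x → inst (exts σ) δ (exts τ x) ≡ exts (inst σ δ ∘ τ) x
  inst-exts σ τ zero    = refl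
  inst-exts σ τ (suc x) = trans (inst-ren suc (exts σ) δ (τ x)) (sym (ren-inst suc σ (τ x)))

  inst-sub : ∀ σ τ t → inst σ δ (sub τ t) ≡ inst (inst σ δ ∘ τ) δ t
  inst-sub σ τ (var x)   = refl
  inst-sub σ τ (lam t)   = cong lam (trans (inst-sub _ _ t) (inst-cong δ t (inst-exts σ τ)))
  inst-sub σ τ (app t u) = cong₂ app (inst-sub σ τ t) (inst-sub σ τ u)
  inst-sub σ τ (sft t)   = cong sft (trans (inst-sub _ _ t) (inst-cong δ t (inst-exts σ τ)))
  inst-sub σ τ (rst t)   = cong rst (inst-sub σ τ t)
  inst-sub σ τ (cv α t)  = cong (rst ∘ plugE (δ α)) (inst-sub σ τ t)

  exts-scoped : ∀ {n} {σ : ℕ → Term} → (∀ x → Scoped n (σ x)) → ∀ x → Scoped (suc n) (exts σ x)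
  exts-scoped h zero    = svar (s≤s z≤n)
  exts-scoped h (suc x) = ren-scoped (h x) (λ _ → s≤s)

  inst-scoped : ∀ {n σ} → (∀ x → Scoped n (σ x)) → ∀ t → Scoped n (inst σ δ t)
  inst-scoped h (var x)   = h x
  inst-scoped h (lam t)   = slam (inst-scoped (exts-scoped h) t)
  inst-scoped h (app t u) = sapp (inst-scoped h t) (inst-scoped h u)
  inst-scoped h (sft t)   = ssft (inst-scoped (exts-scoped h) t)
  inst-scoped h (rst t)   = srst (inst-scoped h t)
  inst-scoped h (cv α t)  = srst (plugE-scoped (δ α) (δ-closed α) (inst-scoped h t))

-- Closing environments and their action on contexts and reduction

record Env : Set where
  field
    σ        : ℕ → Term
    σ-value  : ∀ x → Value (σ x)
    σ-closed : ∀ x → Closed (σ x)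
    δ        : ℕ → ECtx
    δ-closed : ∀ α → ClosedE (δ α)

open Env

infix 25 _⟦_⟧

_⟦_⟧ : Env → Term → Term
ρ ⟦ t ⟧ = inst (σ ρ) (δ ρ) t

⟦⟧-closed : ∀ ρ t → Closed (ρ ⟦ t ⟧)
⟦⟧-closed ρ t = inst-scoped (δ-closed ρ) (σ-closed ρ) t

⟦⟧-value : ∀ ρ {v} → Value v → Value (ρ ⟦ v ⟧)
⟦⟧-value ρ (vvar x) = σ-value ρ x
⟦⟧-value ρ (vlam t) = vlam _

⟦[]₀⟧ : ∀ ρ t u → ρ ⟦ t [ u ]₀ ⟧ ≡ inst (exts (σ ρ)) (δ ρ) t [ ρ ⟦ u ⟧ ]₀
⟦[]₀⟧ ρ t u = begin
  ρ ⟦ t [ u ]₀ ⟧                                       ≡⟨ cong (ρ ⟦_⟧) ([]₀-single t u) ⟩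
  ρ ⟦ sub (single u) t ⟧                               ≡⟨ inst-sub (δ-closed ρ) (σ ρ) (single u) t ⟩
  inst ((ρ ⟦_⟧) ∘ single u) (δ ρ) t                    ≡⟨ inst-cong (δ ρ) t pointwise ⟩
  inst (sub (single (ρ ⟦ u ⟧)) ∘ exts (σ ρ)) (δ ρ) t   ≡⟨ sub-inst (δ-closed ρ) _ (exts (σ ρ)) t ⟨
  sub (single (ρ ⟦ u ⟧)) (inst (exts (σ ρ)) (δ ρ) t)   ≡⟨ []₀-single (inst (exts (σ ρ)) (δ ρ) t) (ρ ⟦ u ⟧) ⟨
  inst (exts (σ ρ)) (δ ρ) t [ ρ ⟦ u ⟧ ]₀               ∎
  where
  open ≡-Reasoning
  pointwise : ∀ x → ρ ⟦ single u x ⟧ ≡ sub (single (ρ ⟦ u ⟧)) (exts (σ ρ) x)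
  pointwise zero    = refl
  -- Environment values are closed, so neither weakening under the binder nor the substitution
  -- affects them.
  pointwise (suc x) = sym (trans (cong (sub _) (ren-closed (σ-closed ρ x))) (sub-closed (σ-closed ρ x)))

instE : Env → ECtx → ECtx
instE ρ □E         = □E
instE ρ (vE v p E) = vE (ρ ⟦ v ⟧) (⟦⟧-value ρ p) (instE ρ E)
instE ρ (Et E u)   = Et (instE ρ E) (ρ ⟦ u ⟧)

-- A delimited context becomes ⟨E⟩ for a pure context E, and instD returns E.
instD : Env → DCtx → ECtx
instD ρ (rD E)   = instE ρ E
instD ρ (cD α E) = δ ρ α ∘E instE ρ E

instF : Env → FCtx → FCtx
instF ρ □F         = □F
instF ρ (vF v p F) = vF (ρ ⟦ v ⟧) (⟦⟧-value ρ p) (instF ρ F)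
instF ρ (Ft F u)   = Ft (instF ρ F) (ρ ⟦ u ⟧)
instF ρ (rF F)     = rF (instF ρ F)
instF ρ (cF α F)   = rF (eToF (δ ρ α) ∘F instF ρ F)

instE-closed : ∀ ρ E → ClosedE (instE ρ E)
instE-closed ρ □E         = tt
instE-closed ρ (vE v p E) = ⟦⟧-closed ρ v , instE-closed ρ E
instE-closed ρ (Et E u)   = instE-closed ρ E , ⟦⟧-closed ρ u

instD-closed : ∀ ρ D → ClosedE (instD ρ D)
instD-closed ρ (rD E)   = instE-closed ρ E
instD-closed ρ (cD α E) = ∘E-closed (δ ρ α) (δ-closed ρ α) (instE-closed ρ E)

⟦plugE⟧ : ∀ ρ E t → ρ ⟦ plugE E t ⟧ ≡ plugE (instE ρ E) (ρ ⟦ t ⟧)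
⟦plugE⟧ ρ □E         t = refl
⟦plugE⟧ ρ (vE v p E) t = cong (app _) (⟦plugE⟧ ρ E t)
⟦plugE⟧ ρ (Et E u)   t = cong (λ s → app s _) (⟦plugE⟧ ρ E t)

⟦plugD⟧ : ∀ ρ D t → ρ ⟦ plugD D t ⟧ ≡ rst (plugE (instD ρ D) (ρ ⟦ t ⟧))
⟦plugD⟧ ρ (rD E)   t = cong rst (⟦plugE⟧ ρ E t)
⟦plugD⟧ ρ (cD α E) t =
  cong rst (trans (cong (plugE (δ ρ α)) (⟦plugE⟧ ρ E t)) (sym (plugE-∘ (δ ρ α) (instE ρ E) _)))

plugF-δ : ∀ ρ α F t → plugF (eToF (δ ρ α) ∘F F) t ≡ plugE (δ ρ α) (plugF F t)
plugF-δ ρ α F t = trans (plugF-∘ (eToF (δ ρ α)) F t) (plugF-eToF (δ ρ α) _)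

⟦plugF⟧ : ∀ ρ F t → ρ ⟦ plugF F t ⟧ ≡ plugF (instF ρ F) (ρ ⟦ t ⟧)
⟦plugF⟧ ρ □F         t = refl
⟦plugF⟧ ρ (vF v p F) t = cong (app _) (⟦plugF⟧ ρ F t)
⟦plugF⟧ ρ (Ft F u)   t = cong (λ s → app s _) (⟦plugF⟧ ρ F t)
⟦plugF⟧ ρ (rF F)     t = cong rst (⟦plugF⟧ ρ F t)
⟦plugF⟧ ρ (cF α F)   t =
  cong rst (trans (cong (plugE (δ ρ α)) (⟦plugF⟧ ρ F t)) (sym (plugF-δ ρ α (instF ρ F) _)))

inst-exts-ren : ∀ ρ t → inst (exts (σ ρ)) (δ ρ) (ren suc t) ≡ ρ ⟦ t ⟧
inst-exts-ren ρ t = trans (inst-ren suc (exts (σ ρ)) (δ ρ) t)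
                          (inst-cong (δ ρ) t (λ x → ren-closed (σ-closed ρ x)))

inst-exts-plugE : ∀ ρ E t → inst (exts (σ ρ)) (δ ρ) (plugE (renE suc E) t) ≡
                            plugE (instE ρ E) (inst (exts (σ ρ)) (δ ρ) t)
inst-exts-plugE ρ □E         t = refl
inst-exts-plugE ρ (vE v p E) t = cong₂ app (inst-exts-ren ρ v) (inst-exts-plugE ρ E t)
inst-exts-plugE ρ (Et E u)   t = cong₂ app (inst-exts-plugE ρ E t) (inst-exts-ren ρ u)

-- The continuation that `shift` captures from `⟨E⟩`. `E` is not renamed under the binder, which is
-- correct for closed `E`.
reify : ECtx → Term
reify E = lam (rst (plugE E (var zero)))

⟦reify⟧ : ∀ ρ D → ρ ⟦ lam (plugD (renD suc D) (var zero)) ⟧ ≡ reify (instD ρ D)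
⟦reify⟧ ρ (rD E)   = cong (lam ∘ rst) (inst-exts-plugE ρ E (var zero))
⟦reify⟧ ρ (cD α E) = cong (lam ∘ rst)
  (trans (cong (plugE (δ ρ α)) (inst-exts-plugE ρ E (var zero))) (sym (plugE-∘ (δ ρ α) (instE ρ E) _)))

shift-closed : ∀ F E t → ClosedE E →
               plugF F (rst (plugE E (sft t))) ⟶ plugF F (rst (t [ reify E ]₀))
shift-closed F E t c =
  subst (λ u → plugF F (rst (plugE E (sft t))) ⟶ plugF F (rst (t [ lam (rst u) ]₀)))
    (plugE-renE E c) (shift F (rD E) t)

-- Values go to values and every delimited context goes to some `⟨E⟩`, so a redex becomes a redex of
-- the same kind and one step stays exactly one step.
⟦⟶⟧ : ∀ ρ {t t′} → t ⟶ t′ → ρ ⟦ t ⟧ ⟶ ρ ⟦ t′ ⟧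
⟦⟶⟧ ρ (βv F t v p) = subst₂ _⟶_
  (sym (⟦plugF⟧ ρ F _))
  (sym (trans (⟦plugF⟧ ρ F _) (cong (plugF (instF ρ F)) (⟦[]₀⟧ ρ t v))))
  (βv (instF ρ F) _ _ (⟦⟧-value ρ p))
⟦⟶⟧ ρ (shift F D t) = subst₂ _⟶_
  (sym (trans (⟦plugF⟧ ρ F _) (cong (plugF (instF ρ F)) (⟦plugD⟧ ρ D _))))
  (sym (trans (⟦plugF⟧ ρ F _) (cong (plugF (instF ρ F) ∘ rst)
    (trans (⟦[]₀⟧ ρ t _) (cong (inst (exts (σ ρ)) (δ ρ) t [_]₀) (⟦reify⟧ ρ D))))))
  (shift-closed (instF ρ F) (instD ρ D) _ (instD-closed ρ D))
⟦⟶⟧ ρ (reset F v p) = subst₂ _⟶_ (sym (⟦plugF⟧ ρ F _)) (sym (⟦plugF⟧ ρ F _))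
  (reset (instF ρ F) _ (⟦⟧-value ρ p))

⟦⟶*⟧ : ∀ ρ {t t′} → t ⟶* t′ → ρ ⟦ t ⟧ ⟶* ρ ⟦ t′ ⟧
⟦⟶*⟧ ρ = gmap (ρ ⟦_⟧) (⟦⟶⟧ ρ)

-- Extending an environment at a fresh name

update : ∀ {A : Set} → ℕ → A → (ℕ → A) → ℕ → A
update x a f y with y ≟ x
... | yes _ = a
... | no  _ = f y

update-same : ∀ {A : Set} x (a : A) f → update x a f x ≡ a
update-same x a f with x ≟ x
... | yes _ = refl
... | no x≢x = ⊥-elim (x≢x refl)

update-below : ∀ {A : Set} {x} {a : A} {f} y → y < x → update x a f y ≡ f y
update-below {x = x} y y<x with y ≟ x
... | yes refl = ⊥-elim (<⇒≢ y<x refl)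
... | no  _    = refl

update-all : ∀ {A : Set} {P : A → Set} {x a f} → P a → (∀ y → P (f y)) → ∀ y → P (update x a f y)
update-all {x = x} p h y with y ≟ x
... | yes _ = p
... | no  _ = h y

update-rel : ∀ {A : Set} {P : A → A → Set} {x a b f g} → P a b → (∀ y → P (f y) (g y)) →
             ∀ y → P (update x a f y) (update x b g y)
update-rel {x = x} p h y with y ≟ x
... | yes _ = p
... | no  _ = h y

bindVar : Env → ℕ → ∀ {v} → Value v → Closed v → Env
bindVar ρ x {v} p c = record
  { σ        = update x v (σ ρ)
  ; σ-value  = update-all {P = Value} p (σ-value ρ)
  ; σ-closed = update-all {P = Closed} c (σ-closed ρ)
  ; δ        = δ ρ
  ; δ-closed = δ-closed ρ
  }

bindCtx : Env → ℕ → ∀ {E} → ClosedE E → Env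
bindCtx ρ α {E} c = record
  { σ        = σ ρ
  ; σ-value  = σ-value ρ
  ; σ-closed = σ-closed ρ
  ; δ        = update α E (δ ρ)
  ; δ-closed = update-all {P = ClosedE} c (δ-closed ρ)
  }

module _ (ρ : Env) (x : ℕ) {v : Term} (p : Value v) (c : Closed v) where

  bindVar-fresh : ∀ t → tb t ≤ x → bindVar ρ x p c ⟦ t ⟧ ≡ ρ ⟦ t ⟧
  bindVar-fresh t l = inst-agree t (λ y y< → update-below y (<-≤-trans y< l)) (λ _ _ → refl)

  -- Bisimulations test contexts at a fresh variable. Binding that variable to `v` turns the test
  -- into the return of an actual value, while the context still reads the old environment.
  bindVar-plugE : ∀ E → tb (plugE E (var zero)) ≤ x →
                  bindVar ρ x p c ⟦ plugE E (var x) ⟧ ≡ plugE (instE ρ E) v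
  bindVar-plugE □E         l = update-same x v (σ ρ)
  bindVar-plugE (vE w q E) l = cong₂ app (bindVar-fresh w (m⊔n≤o⇒m≤o (tb w) _ l))
                                         (bindVar-plugE E (m⊔n≤o⇒n≤o (tb w) _ l))
  bindVar-plugE (Et E u)   l = cong₂ app (bindVar-plugE E (m⊔n≤o⇒m≤o _ (tb u) l))
                                         (bindVar-fresh u (m⊔n≤o⇒n≤o _ (tb u) l))

  bindVar-plugD : ∀ D → tb (plugD D (var zero)) ≤ x →
                  bindVar ρ x p c ⟦ plugD D (var x) ⟧ ≡ rst (plugE (instD ρ D) v)
  bindVar-plugD (rD E)   l = cong rst (bindVar-plugE E l)
  bindVar-plugD (cD α E) l =
    cong rst (trans (cong (plugE (δ ρ α)) (bindVar-plugE E l)) (sym (plugE-∘ (δ ρ α) (instE ρ E) v)))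

  bindVar-plugF : ∀ F → tb (plugF F (var zero)) ≤ x →
                  bindVar ρ x p c ⟦ plugF F (var x) ⟧ ≡ plugF (instF ρ F) v
  bindVar-plugF □F         l = update-same x v (σ ρ)
  bindVar-plugF (vF w q F) l = cong₂ app (bindVar-fresh w (m⊔n≤o⇒m≤o (tb w) _ l))
                                         (bindVar-plugF F (m⊔n≤o⇒n≤o (tb w) _ l))
  bindVar-plugF (Ft F u)   l = cong₂ app (bindVar-plugF F (m⊔n≤o⇒m≤o _ (tb u) l))
                                         (bindVar-fresh u (m⊔n≤o⇒n≤o _ (tb u) l))
  bindVar-plugF (rF F)     l = cong rst (bindVar-plugF F l)
  bindVar-plugF (cF α F)   l =
    cong rst (trans (cong (plugE (δ ρ α)) (bindVar-plugF F l)) (sym (plugF-δ ρ α (instF ρ F) v)))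

-- The counterpart for tests under a fresh `α`, which is bound to the current pure context.
bindCtx-cv : ∀ ρ α {E} (c : ClosedE E) t → cb t ≤ α →
             bindCtx ρ α c ⟦ cv α t ⟧ ≡ rst (plugE E (ρ ⟦ t ⟧))
bindCtx-cv ρ α {E} c t l = cong rst (cong₂ plugE (update-same α E (δ ρ))
  (inst-agree t (λ _ _ → refl) (λ β β< → update-below β (<-≤-trans β< l))))

tb-plugF-mono : ∀ F {t u} → tb t ≤ tb u → tb (plugF F t) ≤ tb (plugF F u)
tb-plugF-mono □F         l = l
tb-plugF-mono (vF v p F) l = ⊔-mono-≤ (≤-refl {tb v}) (tb-plugF-mono F l)
tb-plugF-mono (Ft F u)   l = ⊔-mono-≤ (tb-plugF-mono F l) (≤-refl {tb u})
tb-plugF-mono (rF F)     l = tb-plugF-mono F l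
tb-plugF-mono (cF α F)   l = tb-plugF-mono F l

tb≤tb-plugF : ∀ F t → tb t ≤ tb (plugF F t)
tb≤tb-plugF □F         t = ≤-refl
tb≤tb-plugF (vF v p F) t = m≤n⇒m≤o⊔n (tb v) (tb≤tb-plugF F t)
tb≤tb-plugF (Ft F u)   t = m≤n⇒m≤n⊔o (tb u) (tb≤tb-plugF F t)
tb≤tb-plugF (rF F)     t = tb≤tb-plugF F t
tb≤tb-plugF (cF α F)   t = tb≤tb-plugF F t

module _ (F : FCtx) (D : DCtx) where

  -- `RelC` picks a variable fresh for the whole context; this and `tb-inner` pass freshness on to
  -- its two parts.
  tb-outer : tb (plugF F (var zero)) ≤ tb (plugF (F ∘F dToF D) (var zero))
  tb-outer = subst (λ s → tb (plugF F (var zero)) ≤ tb s) (sym (plugF-∘ F (dToF D) _))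
    (tb-plugF-mono F (tb≤tb-plugF (dToF D) (var zero)))

  tb-inner : tb (plugD D (var zero)) ≤ tb (plugF (F ∘F dToF D) (var zero))
  tb-inner = subst₂ (λ s u → tb s ≤ tb u) (plugF-dToF D _) (sym (plugF-∘ F (dToF D) _))
    (tb≤tb-plugF F _)

-- The closure of a bisimulation under instantiation and plain contexts

-- A machine state: the active term, its pure context up to the nearest delimiter, and the stack `K`
-- of everything outside.
config : FCtx → ECtx → Term → Term
config K E t = plugF K (rst (plugE E t))

config≡plugF : ∀ K E t → config K E t ≡ plugF (K ∘F rF (eToF E)) t
config≡plugF K E t = sym (trans (plugF-∘ K (rF (eToF E)) t) (cong (plugF K ∘ rst) (plugF-eToF E t)))

config-⟶ : ∀ K E {t t′} → t ⟶ t′ → config K E t ⟶ config K E t′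
config-⟶ K E r = subst₂ _⟶_ (sym (config≡plugF K E _)) (sym (config≡plugF K E _)) (plugF-⟶ _ r)

config-reify : ∀ K E G {v} → ClosedE G → Value v →
               config K E (app (reify G) v) ⟶ config (K ∘F rF (eToF E)) G v
config-reify K E G {v} c p = subst (config K E (app (reify G) v) ⟶_)
  (trans (cong (λ s → config K E (rst s)) (sub-plugE G c)) (config≡plugF K E (rst (plugE G v))))
  (config-⟶ K E (βv □F _ v p))

-- The hand-over itself: an instance of an open-stuck term is reread, without reducing, as a
-- configuration that applies what `y` stands for.
config-open : ∀ ρ K F D y v →
  config (K ∘F instF ρ F) (instD ρ D) (app (σ ρ y) (ρ ⟦ v ⟧)) ≡
  plugF K (ρ ⟦ plugF (F ∘F dToF D) (app (var y) v) ⟧)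
config-open ρ K F D y v = trans (plugF-∘ K (instF ρ F) _) (cong (plugF K) (sym (begin
  ρ ⟦ plugF (F ∘F dToF D) w ⟧              ≡⟨ cong (ρ ⟦_⟧) (plugF-∘ F (dToF D) w) ⟩
  ρ ⟦ plugF F (plugF (dToF D) w) ⟧         ≡⟨ cong (λ s → ρ ⟦ plugF F s ⟧) (plugF-dToF D w) ⟩
  ρ ⟦ plugF F (plugD D w) ⟧                ≡⟨ ⟦plugF⟧ ρ F _ ⟩
  plugF (instF ρ F) (ρ ⟦ plugD D w ⟧)      ≡⟨ cong (plugF (instF ρ F)) (⟦plugD⟧ ρ D w) ⟩
  config (instF ρ F) (instD ρ D) (ρ ⟦ w ⟧) ∎)))
  where
  open ≡-Reasoning
  w = app (var y) v

config-cv : ∀ ρ K F α v →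
  config (K ∘F instF ρ F) (δ ρ α) (ρ ⟦ v ⟧) ≡ plugF K (ρ ⟦ plugF F (cv α v) ⟧)
config-cv ρ K F α v = trans (plugF-∘ K (instF ρ F) _) (cong (plugF K) (sym (⟦plugF⟧ ρ F (cv α v))))

⟦cv-app⟧ : ∀ ρ {x α v E} (p : Value v) (d : Closed v) (c : ClosedE E) w → tb w ≤ x → cb w ≤ α →
           bindCtx (bindVar ρ x p d) α c ⟦ cv α (app w (var x)) ⟧ ≡ rst (plugE E (app (ρ ⟦ w ⟧) v))
⟦cv-app⟧ ρ {x} {α} {v} {E} p d c w l k =
  trans (bindCtx-cv (bindVar ρ x p d) α c (app w (var x)) (⊔-lub k z≤n))
        (cong (rst ∘ plugE E) (cong₂ app (bindVar-fresh ρ x p d w l) (update-same x v (σ ρ))))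

-- `RelNF` names the head variable existentially. Forcing it to be `z` keeps the hand-over in
-- `base-app-safe` within the old environment, away from the argument just bound to `x`.
cv-app-head : ∀ F {α z x y u} → cv α (app (var z) (var x)) ≡ plugF F (app (var y) u) → z ≡ y
cv-app-head (cF _ F) e = app-head F (cv-injective e)
  where
  cv-injective : ∀ {α β t u} → cv α t ≡ cv β u → t ≡ u
  cv-injective refl = refl

  app-injective : ∀ {a b c d} → app a b ≡ app c d → a ≡ c × b ≡ d
  app-injective refl = refl , refl

  var≢plugF-app : ∀ F {z t u} → ¬ (var z ≡ plugF F (app t u))
  var≢plugF-app □F ()

  app-head : ∀ F {z x y u} → app (var z) (var x) ≡ plugF F (app (var y) u) → z ≡ y
  app-head □F         refl = refl
  app-head (vF _ _ F) e = ⊥-elim (var≢plugF-app F (proj₂ (app-injective e)))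
  app-head (Ft F _)   e = ⊥-elim (var≢plugF-app F (proj₁ (app-injective e)))

plugD-nonvalue : ∀ D {t} → ¬ Value (plugD D t)
plugD-nonvalue (rD _) ()
plugD-nonvalue (cD _ _) ()

-- Only one direction of progress is a parameter, so the converse implication is this module at
-- `flip R`.
module Simulation (R : Rel) (R-pure : ∀ {p₀ p₁} → R p₀ p₁ → PureT p₀) (progress : Progress R) where

  open Progress progress renaming (step to R-step; val to R-val; ctx to R-ctx; opn to R-opn)

  data TermRel : ℕ → Term → Term → Set
  data ValueRel : Term → Term → Set
  data CtxRel : ECtx → ECtx → Set

  ValuesRel : Env → Env → Set
  ValuesRel ρ₀ ρ₁ = ∀ x → ValueRel (σ ρ₀ x) (σ ρ₁ x)

  CtxsRel : Env → Env → Set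
  CtxsRel ρ₀ ρ₁ = ∀ α → CtxRel (δ ρ₀ α) (δ ρ₁ α)

  -- `val` and `base` relate closed terms, so they hold in every scope and are fixed by renaming and
  -- substitution.
  data TermRel where
    var  : ∀ {n x} → x < n → TermRel n (var x) (var x)
    lam  : ∀ {n t₀ t₁} → TermRel (suc n) t₀ t₁ → TermRel n (lam t₀) (lam t₁)
    app  : ∀ {n t₀ t₁ u₀ u₁} → TermRel n t₀ t₁ → TermRel n u₀ u₁ → TermRel n (app t₀ u₀) (app t₁ u₁)
    sft  : ∀ {n t₀ t₁} → TermRel (suc n) t₀ t₁ → TermRel n (sft t₀) (sft t₁)
    rst  : ∀ {n t₀ t₁} → TermRel n t₀ t₁ → TermRel n (rst t₀) (rst t₁)
    val  : ∀ {n v₀ v₁} → ValueRel v₀ v₁ → TermRel n v₀ v₁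
    base : ∀ {n} α t₀ t₁ ρ₀ ρ₁ → cb t₀ ≤ α → cb t₁ ≤ α → R (cv α t₀) (cv α t₁) →
           ValuesRel ρ₀ ρ₁ → CtxsRel ρ₀ ρ₁ → TermRel n (ρ₀ ⟦ t₀ ⟧) (ρ₁ ⟦ t₁ ⟧)

  -- `cont` is separate from `lam`: `base` relates contexts only as wholes, so it gives no `TermRel`
  -- between the bodies of the reified contexts.
  data ValueRel where
    lam  : ∀ {t₀ t₁} → TermRel 1 t₀ t₁ → ValueRel (lam t₀) (lam t₁)
    cont : ∀ {E₀ E₁} → CtxRel E₀ E₁ → ValueRel (reify E₀) (reify E₁)
    base : ∀ {v₀ v₁} ρ₀ ρ₁ → Value v₀ → Value v₁ → RelV R v₀ v₁ →
           ValuesRel ρ₀ ρ₁ → CtxsRel ρ₀ ρ₁ → ValueRel (ρ₀ ⟦ v₀ ⟧) (ρ₁ ⟦ v₁ ⟧)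

  -- Frames are added next to the hole, in the order in which evaluation enters them, so the
  -- previous context remains a subderivation.
  data CtxRel where
    □    : CtxRel □E □E
    fun  : ∀ {E₀ E₁ v₀ v₁} (p₀ : Value v₀) (p₁ : Value v₁) → CtxRel E₀ E₁ → ValueRel v₀ v₁ →
           CtxRel (E₀ ∘E vE v₀ p₀ □E) (E₁ ∘E vE v₁ p₁ □E)
    arg  : ∀ {E₀ E₁ u₀ u₁} → CtxRel E₀ E₁ → TermRel 0 u₀ u₁ →
           CtxRel (E₀ ∘E Et □E u₀) (E₁ ∘E Et □E u₁)
    base : ∀ x D₀ D₁ ρ₀ ρ₁ → tb (plugD D₀ (var zero)) ≤ x → tb (plugD D₁ (var zero)) ≤ x →
           R (plugD D₀ (var x)) (plugD D₁ (var x)) →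
           ValuesRel ρ₀ ρ₁ → CtxsRel ρ₀ ρ₁ → CtxRel (instD ρ₀ D₀) (instD ρ₁ D₁)

  -- Outside the mutual definition because `shift` captures only up to the nearest delimiter: no
  -- value contains a stack.
  data StackRel : FCtx → FCtx → Set where
    □    : StackRel □F □F
    push : ∀ {K₀ K₁ E₀ E₁} → StackRel K₀ K₁ → CtxRel E₀ E₁ →
           StackRel (K₀ ∘F rF (eToF E₀)) (K₁ ∘F rF (eToF E₁))
    base : ∀ {K₀ K₁} x F₀ F₁ ρ₀ ρ₁ → StackRel K₀ K₁ →
           tb (plugF F₀ (var zero)) ≤ x → tb (plugF F₁ (var zero)) ≤ x →
           R (plugF F₀ (var x)) (plugF F₁ (var x)) →
           ValuesRel ρ₀ ρ₁ → CtxsRel ρ₀ ρ₁ → StackRel (K₀ ∘F instF ρ₀ F₀) (K₁ ∘F instF ρ₁ F₁)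

  -- The forms a pair takes right after a counted step: `pure` when `R` matched it, `run` after a
  -- β-step or a capture, `return` after a delimiter around a value is removed. `run` is also the
  -- initial form.
  data State : Term → Term → Set where
    pure   : ∀ {K₀ K₁ p₀ p₁} ρ₀ ρ₁ → StackRel K₀ K₁ → R p₀ p₁ → ValuesRel ρ₀ ρ₁ → CtxsRel ρ₀ ρ₁ →
             State (plugF K₀ (ρ₀ ⟦ p₀ ⟧)) (plugF K₁ (ρ₁ ⟦ p₁ ⟧))
    run    : ∀ {K₀ K₁ E₀ E₁ t₀ t₁} → StackRel K₀ K₁ → CtxRel E₀ E₁ → TermRel 0 t₀ t₁ →
             State (config K₀ E₀ t₀) (config K₁ E₁ t₁)
    return : ∀ {K₀ K₁ v₀ v₁} → StackRel K₀ K₁ → ValueRel v₀ v₁ → State (plugF K₀ v₀) (plugF K₁ v₁)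

  -- Scoping, renaming and substitution for related pairs

  ValueRel-value : ∀ {v₀ v₁} → ValueRel v₀ v₁ → Value v₀ × Value v₁
  ValueRel-value (lam _)                   = vlam _ , vlam _
  ValueRel-value (cont _)                  = vlam _ , vlam _
  ValueRel-value (base ρ₀ ρ₁ p₀ p₁ _ _ _) = ⟦⟧-value ρ₀ p₀ , ⟦⟧-value ρ₁ p₁

  TermRel-scoped : ∀ {n t₀ t₁} → TermRel n t₀ t₁ → Scoped n t₀ × Scoped n t₁
  ValueRel-closed : ∀ {v₀ v₁} → ValueRel v₀ v₁ → Closed v₀ × Closed v₁
  CtxRel-closed : ∀ {E₀ E₁} → CtxRel E₀ E₁ → ClosedE E₀ × ClosedE E₁

  TermRel-scoped (var l)   = svar l , svar l
  TermRel-scoped (lam t)   = Product.map slam slam (TermRel-scoped t)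
  TermRel-scoped (app t u) = Product.zip sapp sapp (TermRel-scoped t) (TermRel-scoped u)
  TermRel-scoped (sft t)   = Product.map ssft ssft (TermRel-scoped t)
  TermRel-scoped (rst t)   = Product.map srst srst (TermRel-scoped t)
  TermRel-scoped (val v)   = Product.map closed⇒scoped closed⇒scoped (ValueRel-closed v)
  TermRel-scoped (base α t₀ t₁ ρ₀ ρ₁ _ _ _ _ _) =
    closed⇒scoped (⟦⟧-closed ρ₀ t₀) , closed⇒scoped (⟦⟧-closed ρ₁ t₁)

  ValueRel-closed (lam t) = Product.map slam slam (TermRel-scoped t)
  ValueRel-closed (cont {E₀} {E₁} E) = let c₀ , c₁ = CtxRel-closed E in
    slam (srst (plugE-scoped E₀ c₀ (svar (s≤s z≤n)))) , slam (srst (plugE-scoped E₁ c₁ (svar (s≤s z≤n))))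
  ValueRel-closed (base {v₀} {v₁} ρ₀ ρ₁ _ _ _ _ _) = ⟦⟧-closed ρ₀ v₀ , ⟦⟧-closed ρ₁ v₁

  CtxRel-closed □ = tt , tt
  CtxRel-closed (fun {E₀} {E₁} _ _ E v) =
    let c₀ , c₁ = CtxRel-closed E ; s₀ , s₁ = ValueRel-closed v in
    ∘E-closed E₀ c₀ (s₀ , tt) , ∘E-closed E₁ c₁ (s₁ , tt)
  CtxRel-closed (arg {E₀} {E₁} E u) =
    let c₀ , c₁ = CtxRel-closed E ; s₀ , s₁ = TermRel-scoped u in
    ∘E-closed E₀ c₀ (tt , s₀) , ∘E-closed E₁ c₁ (tt , s₁)
  CtxRel-closed (base _ D₀ D₁ ρ₀ ρ₁ _ _ _ _ _) = instD-closed ρ₀ D₀ , instD-closed ρ₁ D₁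

  TermRel-ren : ∀ {n m ρ t₀ t₁} → TermRel n t₀ t₁ → (∀ x → x < n → ρ x < m) →
                TermRel m (ren ρ t₀) (ren ρ t₁)
  TermRel-ren (var l)   h = var (h _ l)
  TermRel-ren (lam t)   h = lam (TermRel-ren t (ext-scoped h))
  TermRel-ren (app t u) h = app (TermRel-ren t h) (TermRel-ren u h)
  TermRel-ren (sft t)   h = sft (TermRel-ren t (ext-scoped h))
  TermRel-ren (rst t)   h = rst (TermRel-ren t h)
  TermRel-ren (val v)   h = let c₀ , c₁ = ValueRel-closed v in
    subst₂ (TermRel _) (sym (ren-closed c₀)) (sym (ren-closed c₁)) (val v)
  TermRel-ren (base α t₀ t₁ ρ₀ ρ₁ l₀ l₁ r vs Es) h =
    subst₂ (TermRel _) (sym (ren-closed (⟦⟧-closed ρ₀ t₀))) (sym (ren-closed (⟦⟧-closed ρ₁ t₁)))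
      (base α t₀ t₁ ρ₀ ρ₁ l₀ l₁ r vs Es)

  exts-TermRel : ∀ {n m σ₀ σ₁} → (∀ x → x < n → TermRel m (σ₀ x) (σ₁ x)) →
                 ∀ x → x < suc n → TermRel (suc m) (exts σ₀ x) (exts σ₁ x)
  exts-TermRel h zero    _       = var (s≤s z≤n)
  exts-TermRel h (suc x) (s≤s l) = TermRel-ren (h x l) (λ _ → s≤s)

  TermRel-sub : ∀ {n m σ₀ σ₁ t₀ t₁} → TermRel n t₀ t₁ → (∀ x → x < n → TermRel m (σ₀ x) (σ₁ x)) →
                TermRel m (sub σ₀ t₀) (sub σ₁ t₁)
  TermRel-sub (var l)   h = h _ l
  TermRel-sub (lam t)   h = lam (TermRel-sub t (exts-TermRel h))
  TermRel-sub (app t u) h = app (TermRel-sub t h) (TermRel-sub u h)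
  TermRel-sub (sft t)   h = sft (TermRel-sub t (exts-TermRel h))
  TermRel-sub (rst t)   h = rst (TermRel-sub t h)
  TermRel-sub (val v)   h = let c₀ , c₁ = ValueRel-closed v in
    subst₂ (TermRel _) (sym (sub-closed c₀)) (sym (sub-closed c₁)) (val v)
  TermRel-sub (base α t₀ t₁ ρ₀ ρ₁ l₀ l₁ r vs Es) h =
    subst₂ (TermRel _) (sym (sub-closed (⟦⟧-closed ρ₀ t₀))) (sym (sub-closed (⟦⟧-closed ρ₁ t₁)))
      (base α t₀ t₁ ρ₀ ρ₁ l₀ l₁ r vs Es)

  TermRel-[]₀ : ∀ {t₀ t₁ v₀ v₁} → TermRel 1 t₀ t₁ → ValueRel v₀ v₁ → TermRel 0 (t₀ [ v₀ ]₀) (t₁ [ v₁ ]₀)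
  TermRel-[]₀ t v = TermRel-sub t (λ { zero _ → val v ; (suc x) (s≤s ()) })

  TermRel-refl : ∀ {n t} → Plain t → Scoped n t → TermRel n t t
  TermRel-refl (pvar x)   (svar l)   = var l
  TermRel-refl (plam p)   (slam s)   = lam (TermRel-refl p s)
  TermRel-refl (papp p q) (sapp s r) = app (TermRel-refl p s) (TermRel-refl q r)
  TermRel-refl (psft p)   (ssft s)   = sft (TermRel-refl p s)
  TermRel-refl (prst p)   (srst s)   = rst (TermRel-refl p s)

  ValueRel-refl : ∀ {v} → Value v → Plain v → Closed v → ValueRel v v
  ValueRel-refl (vvar x) _        (svar ())
  ValueRel-refl (vlam t) (plam p) (slam s) = lam (TermRel-refl p s)

  TermRel-plugC : ∀ {n C t₀ t₁} → PlainC C → ScopedC n C → (∀ {m} → TermRel m t₀ t₁) →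
                  TermRel n (plugC C t₀) (plugC C t₁)
  TermRel-plugC phole        shole        h = h
  TermRel-plugC (plamC c)    (slamC s)    h = lam (TermRel-plugC c s h)
  TermRel-plugC (pappRC p c) (sappRC r s) h = app (TermRel-refl p r) (TermRel-plugC c s h)
  TermRel-plugC (pappLC c p) (sappLC s r) h = app (TermRel-plugC c s h) (TermRel-refl p r)
  TermRel-plugC (psftC c)    (ssftC s)    h = sft (TermRel-plugC c s h)
  TermRel-plugC (prstC c)    (srstC s)    h = rst (TermRel-plugC c s h)

  -- The step count is fixed at `n`, and `later` is the induction hypothesis for its predecessor.
  -- Whatever does not end in `later` costs no step and must terminate by recursion on derivations.
  module Level (n : ℕ)
    (later : ∀ {m s₀ s₁} → n ≡ suc m → State s₀ s₁ → EvalsIn m s₀ → EvalsToValue s₁) where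

    Simulates : Term → Term → Set
    Simulates s₀ s₁ = EvalsIn n s₀ → EvalsToValue s₁

    by-step : ∀ {s₀ s₀′ s₁ s₁′} → s₀ ⟶ s₀′ → s₁ ⟶* s₁′ → State s₀′ s₁′ → Simulates s₀ s₁
    by-step r rs s e =
      let _ , n≡ , e′   = EvalsIn-⟶ r e
          v , rs′ , p   = later n≡ s e′
      in v , rs ◅◅ rs′ , p

    by-⟶* : ∀ {s₀ s₁ s₁′} → s₁ ⟶* s₁′ → Simulates s₀ s₁′ → Simulates s₀ s₁
    by-⟶* rs h e = let v , rs′ , p = h e in v , rs ◅◅ rs′ , p

    -- Like `ReturnSafe`, the obligation on whatever receives control. Being a predicate, it can be
    -- passed as a hypothesis where a recursive call would not be structural.
    AppSafe : Term → Term → Set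
    AppSafe u₀ u₁ = ∀ {K₀ K₁ E₀ E₁ v₀ v₁} → StackRel K₀ K₁ → CtxRel E₀ E₁ → ValueRel v₀ v₁ →
                    Simulates (config K₀ E₀ (app u₀ v₀)) (config K₁ E₁ (app u₁ v₁))

    ReturnSafe : ECtx → ECtx → Set
    ReturnSafe E₀ E₁ = ∀ {K₀ K₁ v₀ v₁} → StackRel K₀ K₁ → ValueRel v₀ v₁ →
                       Simulates (config K₀ E₀ v₀) (config K₁ E₁ v₁)

    pure-step : ∀ {K₀ K₁ p₀ p₀′ p₁} ρ₀ ρ₁ → StackRel K₀ K₁ → ValuesRel ρ₀ ρ₁ → CtxsRel ρ₀ ρ₁ →
                R p₀ p₁ → p₀ ⟶ p₀′ → Simulates (plugF K₀ (ρ₀ ⟦ p₀ ⟧)) (plugF K₁ (ρ₁ ⟦ p₁ ⟧))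
    pure-step {K₀} {K₁} ρ₀ ρ₁ K vs Es r red = let p₁′ , reds , r′ = R-step r red in
      by-step (plugF-⟶ K₀ (⟦⟶⟧ ρ₀ red)) (plugF-⟶* K₁ (⟦⟶*⟧ ρ₁ reds)) (pure ρ₀ ρ₁ K r′ vs Es)

    -- `RelC` splits the stuck context: the outer part joins the stack and the delimited part
    -- becomes the current context. Safety is asked only of head variables, so the caller decides
    -- where it comes from.
    open-safe : ∀ {K₀ K₁ p₀ p₁} ρ₀ ρ₁ → StackRel K₀ K₁ → ValuesRel ρ₀ ρ₁ → CtxsRel ρ₀ ρ₁ →
                RelNF R p₀ p₁ →
                (∀ F y {v} → p₀ ≡ plugF F (app (var y) v) → AppSafe (σ ρ₀ y) (σ ρ₁ y)) →
                Simulates (plugF K₀ (ρ₀ ⟦ p₀ ⟧)) (plugF K₁ (ρ₁ ⟦ p₁ ⟧))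
    open-safe {K₀} {K₁} ρ₀ ρ₁ K vs Es
      (_ , _ , y , v₀ , v₁ , q₀ , q₁ , refl , refl , (F₀ , D₀ , F₁ , D₁ , refl , refl , r-inner , r-outer) , rv) safe =
      subst₂ Simulates (config-open ρ₀ K₀ F₀ D₀ y v₀) (config-open ρ₁ K₁ F₁ D₁ y v₁)
        (safe _ y refl
          (base _ F₀ F₁ ρ₀ ρ₁ K (m≤n⇒m≤n⊔o _ (tb-outer F₀ D₀)) (m≤n⇒m≤o⊔n _ (tb-outer F₁ D₁)) r-outer vs Es)
          (base _ D₀ D₁ ρ₀ ρ₁ (m≤n⇒m≤n⊔o _ (tb-inner F₀ D₀)) (m≤n⇒m≤o⊔n _ (tb-inner F₁ D₁)) r-inner vs Es)
          (base ρ₀ ρ₁ q₀ q₁ rv vs Es))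

    -- With `x` bound to the argument and `α` to the current context, the application is an instance
    -- of the test in `RelV`. If `w₀` is an abstraction the left side steps; if it is a variable,
    -- control passes to its value in the environment.
    base-app-safe : ∀ {w₀ w₁} ρ₀ ρ₁ → Value w₀ → RelV R w₀ w₁ → ValuesRel ρ₀ ρ₁ → CtxsRel ρ₀ ρ₁ →
                    (∀ z → AppSafe (σ ρ₀ z) (σ ρ₁ z)) → AppSafe (ρ₀ ⟦ w₀ ⟧) (ρ₁ ⟦ w₁ ⟧)
    base-app-safe {w₀} {w₁} ρ₀ ρ₁ q r vs Es safe {K₀} {K₁} K E v =
      subst₂ Simulates
        (cong (plugF K₀) (⟦cv-app⟧ ρ₀ p₀ d₀ c₀ w₀ (m≤m⊔n (tb w₀) (tb w₁)) (m≤m⊔n (cb w₀) (cb w₁))))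
        (cong (plugF K₁) (⟦cv-app⟧ ρ₁ p₁ d₁ c₁ w₁ (m≤n⊔m (tb w₀) (tb w₁)) (m≤n⊔m (cb w₀) (cb w₁))))
        (applied q r (m≤m⊔n (tb w₀) (tb w₁)))
      where
      x = tb w₀ ⊔ tb w₁
      α = cb w₀ ⊔ cb w₁
      p₀ = proj₁ (ValueRel-value v)
      p₁ = proj₂ (ValueRel-value v)
      d₀ = proj₁ (ValueRel-closed v)
      d₁ = proj₂ (ValueRel-closed v)
      c₀ = proj₁ (CtxRel-closed E)
      c₁ = proj₂ (CtxRel-closed E)
      θ₀ = bindCtx (bindVar ρ₀ x p₀ d₀) α c₀
      θ₁ = bindCtx (bindVar ρ₁ x p₁ d₁) α c₁

      vs′ : ValuesRel θ₀ θ₁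
      vs′ = update-rel {P = ValueRel} v vs

      Es′ : CtxsRel θ₀ θ₁
      Es′ = update-rel {P = CtxRel} E Es

      -- Generalised over `w` so that matching leaves `x` and `α`, computed from `w₀`, alone. For a
      -- variable `z` the bound `tb w ≤ x` reads `z < x`.
      applied : ∀ {w} → Value w → R (cv α (app w (var x))) (cv α (app w₁ (var x))) → tb w ≤ x →
                Simulates (plugF K₀ (θ₀ ⟦ cv α (app w (var x)) ⟧)) (plugF K₁ (θ₁ ⟦ cv α (app w₁ (var x)) ⟧))
      applied (vlam b) r _ = pure-step θ₀ θ₁ K vs′ Es′ r (βv (cF α □F) b (var x) (vvar x))
      applied (vvar z) r z<x =
        let _ , (reds , _) , nf = R-opn (cF α □F) z (var x) (vvar x) r in
        by-⟶* (plugF-⟶* K₁ (⟦⟶*⟧ θ₁ reds)) (open-safe θ₀ θ₁ K vs′ Es′ nf head)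
        where
        head : ∀ F y {u} → cv α (app (var z) (var x)) ≡ plugF F (app (var y) u) →
               AppSafe (σ θ₀ y) (σ θ₁ y)
        head F y e with cv-app-head F e
        ... | refl = subst₂ AppSafe (sym (update-below z z<x)) (sym (update-below z z<x)) (safe z)

    -- The recursion descends into the environment stored in `base`. An application leads only to a
    -- step or to another application, so this is settled before contexts are treated.
    app-safe : ∀ {u₀ u₁} → ValueRel u₀ u₁ → AppSafe u₀ u₁
    app-safe (lam t) {K₀} {K₁} {E₀} {E₁} K E v = let p₀ , p₁ = ValueRel-value v in
      by-step (config-⟶ K₀ E₀ (βv □F _ _ p₀)) (config-⟶ K₁ E₁ (βv □F _ _ p₁) ◅ ε)
        (run K E (TermRel-[]₀ t v))
    app-safe (cont {G₀} {G₁} G) {K₀} {K₁} {E₀} {E₁} K E v =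
      let p₀ , p₁ = ValueRel-value v ; c₀ , c₁ = CtxRel-closed G in
      by-step (config-reify K₀ E₀ G₀ c₀ p₀) (config-reify K₁ E₁ G₁ c₁ p₁ ◅ ε)
        (run (push K E) G (val v))
    app-safe (base {w₀} {w₁} ρ₀ ρ₁ q₀ _ r vs Es) =
      base-app-safe {w₀} {w₁} ρ₀ ρ₁ q₀ r vs Es (λ z → app-safe (vs z))

    -- Safety of the environment's contexts is a hypothesis because `run-safe` binds a context that
    -- is not a subderivation of its term.
    nonvalue-safe : ∀ {K₀ K₁ p₀ p₁} ρ₀ ρ₁ → StackRel K₀ K₁ → ValuesRel ρ₀ ρ₁ → CtxsRel ρ₀ ρ₁ →
                    (∀ α → ReturnSafe (δ ρ₀ α) (δ ρ₁ α)) → ¬ Value p₀ → R p₀ p₁ →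
                    Simulates (plugF K₀ (ρ₀ ⟦ p₀ ⟧)) (plugF K₁ (ρ₁ ⟦ p₁ ⟧))
    nonvalue-safe {K₀} {K₁} {p₀} ρ₀ ρ₁ K vs Es safe ¬p r with shape p₀
    ... | value p           = ⊥-elim (¬p p)
    ... | reduces red       = pure-step ρ₀ ρ₁ K vs Es r red
    ... | controlStuck E t  = ⊥-elim (plugE-sft-impure E (R-pure r))
    ... | openStuck F y q   = let _ , (reds , _) , nf = R-opn F y _ q r in
      by-⟶* (plugF-⟶* K₁ (⟦⟶*⟧ ρ₁ reds)) (open-safe ρ₀ ρ₁ K vs Es nf (λ _ z _ → app-safe (vs z)))
    -- By uniqueness of the outer part, the decomposition from `RelC` has `F₀` and `F₁` outside.
    -- They join the stack, and what `α` stands for receives the value.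
    ... | ctxStuck F₀ α {v₀} q₀ with R-ctx F₀ α _ q₀ r
    ...   | F₁ , v₁ , q₁ , (reds , _) , (F₀′ , D₀ , F₁′ , D₁ , e₀ , e₁ , _ , r-outer) , rv
            with ∘dToF-injectiveˡ (rD □E) D₀ e₀ | ∘dToF-injectiveˡ (rD □E) D₁ e₁
    ...     | refl | refl =
      by-⟶* (plugF-⟶* K₁ (⟦⟶*⟧ ρ₁ reds))
        (subst₂ Simulates (config-cv ρ₀ K₀ F₀ α v₀) (config-cv ρ₁ K₁ F₁ α v₁)
          (safe α
            (base _ F₀ F₁ ρ₀ ρ₁ K (m≤n⇒m≤n⊔o _ (tb-outer F₀ (rD □E))) (m≤n⇒m≤o⊔n _ (tb-outer F₁ (rD □E)))
              r-outer vs Es)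
            (base ρ₀ ρ₁ q₀ q₁ rv vs Es)))

    -- Returning `u` to `E[v □]` is applying `v` to `u` in `E`, so `app-safe` suffices without
    -- recursion on `E`.
    fun-safe : ∀ {E₀ E₁ v₀ v₁} (p₀ : Value v₀) (p₁ : Value v₁) → CtxRel E₀ E₁ → ValueRel v₀ v₁ →
               ReturnSafe (E₀ ∘E vE v₀ p₀ □E) (E₁ ∘E vE v₁ p₁ □E)
    fun-safe {E₀} {E₁} p₀ p₁ E v {K₀} {K₁} K u =
      subst₂ Simulates (cong (plugF K₀ ∘ rst) (sym (plugE-∘ E₀ _ _))) (cong (plugF K₁ ∘ rst) (sym (plugE-∘ E₁ _ _)))
        (app-safe v K E u)

    □-safe : ReturnSafe □E □E
    □-safe {K₀} {K₁} K v = let p₀ , p₁ = ValueRel-value v in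
      by-step (reset K₀ _ p₀) (reset K₁ _ p₁ ◅ ε) (return K v)

    return-safe : ∀ {E₀ E₁} → CtxRel E₀ E₁ → ReturnSafe E₀ E₁
    -- Apart from `return-safe` so that `run-safe` can call it on an application: there `u` is a
    -- subderivation, but `arg E u` is not.
    arg-safe : ∀ {E₀ E₁ t₀ t₁} → CtxRel E₀ E₁ → TermRel 0 t₀ t₁ →
               ReturnSafe (E₀ ∘E Et □E t₀) (E₁ ∘E Et □E t₁)
    -- Safety of E is a hypothesis, not a call to return-safe, so that the recursion is
    -- structural in the term although E grows.
    run-safe : ∀ {E₀ E₁ K₀ K₁ t₀ t₁} → TermRel 0 t₀ t₁ → CtxRel E₀ E₁ → ReturnSafe E₀ E₁ →
               StackRel K₀ K₁ → Simulates (config K₀ E₀ t₀) (config K₁ E₁ t₁)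

    return-safe □               = □-safe
    return-safe (fun p₀ p₁ E v) = fun-safe p₀ p₁ E v
    return-safe (arg E u)       = arg-safe E u
    return-safe (base x D₀ D₁ ρ₀ ρ₁ l₀ l₁ r vs Es) {K₀} {K₁} K v =
      let p₀ , p₁ = ValueRel-value v ; c₀ , c₁ = ValueRel-closed v in
      subst₂ Simulates (cong (plugF K₀) (bindVar-plugD ρ₀ x p₀ c₀ D₀ l₀)) (cong (plugF K₁) (bindVar-plugD ρ₁ x p₁ c₁ D₁ l₁))
        (nonvalue-safe (bindVar ρ₀ x p₀ c₀) (bindVar ρ₁ x p₁ c₁) K (update-rel {P = ValueRel} v vs) Es
          (λ α → return-safe (Es α)) (plugD-nonvalue D₀) r)

    arg-safe {E₀} {E₁} E u {K₀} {K₁} K v =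
      let p₀ , p₁ = ValueRel-value v in
      subst₂ Simulates
        (cong (plugF K₀ ∘ rst) (trans (plugE-∘ E₀ _ _) (sym (plugE-∘ E₀ _ _))))
        (cong (plugF K₁ ∘ rst) (trans (plugE-∘ E₁ _ _) (sym (plugE-∘ E₁ _ _))))
        (run-safe u (fun p₀ p₁ E v) (fun-safe p₀ p₁ E v) K)

    run-safe (var ())
    run-safe (lam t)   E safe K = safe K (lam t)
    run-safe (val v)   E safe K = safe K v
    run-safe {E₀} {E₁} {K₀} {K₁} (app t u) E safe K =
      subst₂ Simulates (cong (plugF K₀ ∘ rst) (plugE-∘ E₀ _ _)) (cong (plugF K₁ ∘ rst) (plugE-∘ E₁ _ _))
        (run-safe t (arg E u) (arg-safe E u) K)
    run-safe {E₀} {E₁} {K₀} {K₁} (sft t) E safe K = let c₀ , c₁ = CtxRel-closed E in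
      by-step (shift-closed K₀ E₀ _ c₀) (shift-closed K₁ E₁ _ c₁ ◅ ε) (run K □ (TermRel-[]₀ t (cont E)))
    run-safe {E₀} {E₁} {K₀} {K₁} (rst t) E safe K =
      subst₂ Simulates (sym (config≡plugF K₀ E₀ _)) (sym (config≡plugF K₁ E₁ _))
        (run-safe t □ □-safe (push K E))
    run-safe {E₀} {E₁} {K₀} {K₁} (base α t₀ t₁ ρ₀ ρ₁ l₀ l₁ r vs Es) E safe K =
      let c₀ , c₁ = CtxRel-closed E in
      subst₂ Simulates (cong (plugF K₀) (bindCtx-cv ρ₀ α c₀ t₀ l₀)) (cong (plugF K₁) (bindCtx-cv ρ₁ α c₁ t₁ l₁))
        (nonvalue-safe (bindCtx ρ₀ α c₀) (bindCtx ρ₁ α c₁) K vs (update-rel {P = CtxRel} E Es)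
          -- The context just bound to `α` is safe by hypothesis, the others by recursion into the
          -- stored environment.
          (update-rel {P = ReturnSafe} safe (λ β → return-safe (Es β))) (λ ()) r)

    -- Recursion on the stack, jointly with `pure-safe`: a value returned to a `base` segment makes
    -- `F[x]` a pair of `R` over the remaining stack, which is smaller if that pair is again a
    -- value.
    stack-safe : ∀ {K₀ K₁ v₀ v₁} → StackRel K₀ K₁ → ValueRel v₀ v₁ → Simulates (plugF K₀ v₀) (plugF K₁ v₁)
    pure-safe : ∀ {K₀ K₁ p₀ p₁} ρ₀ ρ₁ → StackRel K₀ K₁ → ValuesRel ρ₀ ρ₁ → CtxsRel ρ₀ ρ₁ → R p₀ p₁ →
                PureT p₀ → Simulates (plugF K₀ (ρ₀ ⟦ p₀ ⟧)) (plugF K₁ (ρ₁ ⟦ p₁ ⟧))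

    stack-safe □ v _ = _ , ε , proj₂ (ValueRel-value v)
    stack-safe (push {K₀} {K₁} {E₀} {E₁} K E) v =
      subst₂ Simulates (config≡plugF K₀ E₀ _) (config≡plugF K₁ E₁ _) (return-safe E K v)
    stack-safe (base {K₀} {K₁} x F₀ F₁ ρ₀ ρ₁ K l₀ l₁ r vs Es) v =
      let p₀ , p₁ = ValueRel-value v ; c₀ , c₁ = ValueRel-closed v in
      subst₂ Simulates
        (trans (cong (plugF K₀) (bindVar-plugF ρ₀ x p₀ c₀ F₀ l₀)) (sym (plugF-∘ K₀ _ _)))
        (trans (cong (plugF K₁) (bindVar-plugF ρ₁ x p₁ c₁ F₁ l₁)) (sym (plugF-∘ K₁ _ _)))
        (pure-safe (bindVar ρ₀ x p₀ c₀) (bindVar ρ₁ x p₁ c₁) K (update-rel {P = ValueRel} v vs) Es r (R-pure r))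

    pure-safe {K₁ = K₁} ρ₀ ρ₁ K vs Es r (pval q₀) = let _ , (reds , _) , q₁ , rv = R-val r q₀ in
      by-⟶* (plugF-⟶* K₁ (⟦⟶*⟧ ρ₁ reds)) (stack-safe K (base ρ₀ ρ₁ q₀ q₁ rv vs Es))
    pure-safe ρ₀ ρ₁ K vs Es r (prs t)   = nonvalue-safe ρ₀ ρ₁ K vs Es (return-safe ∘ Es) (λ ()) r
    pure-safe ρ₀ ρ₁ K vs Es r (pcv α t) = nonvalue-safe ρ₀ ρ₁ K vs Es (return-safe ∘ Es) (λ ()) r

    state-safe : ∀ {s₀ s₁} → State s₀ s₁ → Simulates s₀ s₁
    state-safe (pure ρ₀ ρ₁ K r vs Es) = pure-safe ρ₀ ρ₁ K vs Es r (R-pure r)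
    state-safe (run K E t)            = run-safe t E (return-safe E) K
    state-safe (return K v)           = stack-safe K v

  State-evaluates : ∀ n {s₀ s₁} → State s₀ s₁ → EvalsIn n s₀ → EvalsToValue s₁
  State-evaluates zero    = Level.state-safe zero (λ ())
  State-evaluates (suc n) = Level.state-safe (suc n) (λ { refl → State-evaluates n })

  plugC-evaluates : ∀ {α t₀ t₁ τ C} → Plain t₀ → Plain t₁ → R (cv α t₀) (cv α t₁) →
    cb t₀ ≤ α → cb t₁ ≤ α → ClosingSubst τ → PlainC C → ClosedC C →
    EvalsToValue (rst (plugC C (sub τ t₀))) → EvalsToValue (rst (plugC C (sub τ t₁)))
  plugC-evaluates {α} {t₀} {t₁} {τ} pt₀ pt₁ r l₀ l₁ closing pc cc (v , reds , p) =
    let n , e = evalsIn reds p in State-evaluates n (run □ □ (TermRel-plugC pc cc sub-rel)) e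
    where
    ρ : Env
    ρ = record
      { σ        = τ
      ; σ-value  = proj₁ ∘ closing
      ; σ-closed = proj₂ ∘ proj₂ ∘ closing
      -- Plain terms contain no context variables, so trivial contexts do; the fresh `α` is bound in
      -- `run-safe` to the context in which the term runs.
      ; δ        = λ _ → □E
      ; δ-closed = λ _ → tt
      }

    sub-rel : ∀ {m} → TermRel m (sub τ t₀) (sub τ t₁)
    sub-rel = subst₂ (TermRel _) (inst-plain pt₀) (inst-plain pt₁)
      (base α t₀ t₁ ρ ρ l₀ l₁ r
        (λ x → let q , pl , c = closing x in ValueRel-refl q pl c)
        (λ _ → □))

-- Every closing substitution fixes closed terms; this one serves as a witness.
identities : ℕ → Term
identities _ = lam (var zero)

identities-closing : ClosingSubst identities
identities-closing _ = vlam _ , plam (pvar zero) , slam (svar (s≤s z≤n))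

theorem6p24 : ∀ t₀ t₁ → Plain t₀ → Plain t₁ → t₀ ≈ₒᵗ t₁ →
    (t₀ ≅p° t₁) × (Closed t₀ → Closed t₁ → t₀ ≅p t₁)
theorem6p24 t₀ t₁ p₀ p₁ (R , bisim , r) = open-equiv , closed-equiv
  where
  open IsPureNFBisim bisim

  l₀ : cb t₀ ≤ cb t₀ ⊔ cb t₁
  l₀ = m≤m⊔n (cb t₀) (cb t₁)

  l₁ : cb t₁ ≤ cb t₀ ⊔ cb t₁
  l₁ = m≤n⊔m (cb t₀) (cb t₁)

  open-equiv : t₀ ≅p° t₁
  open-equiv σ closing C pc cc = mk⇔
    (Simulation.plugC-evaluates R (proj₁ ∘ pure) fwd p₀ p₁ r l₀ l₁ closing pc cc)
    (Simulation.plugC-evaluates (flip R) (proj₂ ∘ pure) bwd p₁ p₀ r l₁ l₀ closing pc cc)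

  closed-equiv : Closed t₀ → Closed t₁ → t₀ ≅p t₁
  closed-equiv c₀ c₁ = subst₂ _≅p_ (sub-closed c₀) (sub-closed c₁)
    (open-equiv identities identities-closing)
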